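{- Every pair $(G,T)$, where $G$ is a connected graph and $T\subseteq V(G)$, satisfies exactly one of the following three properties, and each of the three properties is satisfied by at least one such pair (in other words, the class $\{(G,T) : G \text{ is a connected graph and } T\subseteq V(G)\}$ is partitioned into three nonempty subclasses defined by these properties): (A) $G$ contains a $T'$-join for every $T'\subseteq V(G)$ with $|T'\triangle T|<\infty$; (B) for every $T'\subseteq V(G)$ with $|T'\triangle T|$ finite, $G$ contains a $T'$-join if $|T'\triangle T|$ is even, and $G$ does not contain a $T'$-join if $|T'\triangle T|$ is odd; (C) for every $T'\subseteq V(G)$ with $|T'\triangle T|$ finite, $G$ contains a $T'$-join if $|T'\triangle T|$ is odd, and $G$ does not contain a $T'$-join if $|T'\triangle T|$ is even.
   Context: Graphs are undirected, may have multiple edges, have no loops, and may be finite or infinite of arbitrary cardinality; a connected graph has at least one vertex. Here $T'\triangle T=(T\setminus T')\cup(T'\setminus T)$ denotes the symmetric difference. Paths are finite. For a graph $G$ and $T\subseteq V(G)$ (finite or infinite, possibly empty), a $T$-join in $G$ is a system $\mathcal{P}$ of pairwise edge-disjoint finite paths in $G$ such that the sets of endvertices of the paths in $\mathcal{P}$ form a partition of $T$ into two-element sets (that is, every $v\in T$ is an endvertex of exactly one path of $\mathcal{P}$, and each path of $\mathcal{P}$ has two distinct endvertices, both in $T$). The empty system is a $\varnothing$-join. -}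

module Defs where

open import Level using (Level; suc)
open import Data.List.Base using (List; []; _∷_; length)
open import Data.List.Membership.Propositional using () renaming (_∈_ to _∈ˡ_)
open import Data.List.Relation.Binary.Disjoint.Propositional using (Disjoint)
open import Data.List.Relation.Unary.Unique.Propositional using (Unique)
open import Data.Nat.Base using (ℕ)
open import Data.Nat.Divisibility using (_∣_; _∤_)
open import Data.Product using (_×_; ∃; ∃-syntax; ∃!)
open import Data.Sum.Base using (_⊎_)
open import Function.Bundles using (_⇔_)
open import Relation.Binary.PropositionalEquality using (_≡_; _≢_)
open import Relation.Nullary using (¬_)
open import Relation.Unary using (Pred; _∈_; _∪_; _∖_)

-- An undirected loopless multigraph.  Each edge names its two ends in some
-- order; the order carries no meaning, since edges are only used through Joins.
record Graph (ℓ : Level) : Set (suc ℓ) where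
  field
    V        : Set ℓ
    E        : Set ℓ
    end₁     : E → V
    end₂     : E → V
    loopless : ∀ e → end₁ e ≢ end₂ e

  Joins : E → V → V → Set ℓ
  Joins e u v = (end₁ e ≡ u × end₂ e ≡ v) ⊎ (end₁ e ≡ v × end₂ e ≡ u)

  data Walk : V → V → Set ℓ where
    nil  : ∀ {u} → Walk u u
    cons : ∀ {u w v} (e : E) → Joins e u w → Walk w v → Walk u v

  vertices : ∀ {u v} → Walk u v → List V
  vertices {u} nil          = u ∷ []
  vertices {u} (cons _ _ p) = u ∷ vertices p

  edges : ∀ {u v} → Walk u v → List E
  edges nil          = []
  edges (cons e _ p) = e ∷ edges p

  record Path (u v : V) : Set ℓ where
    field
      walk   : Walk u v
      simple : Unique (vertices walk)

  pathEdges : ∀ {u v} → Path u v → List E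
  pathEdges p = edges (Path.walk p)

open Graph public using (V)

Connected : ∀ {ℓ} → Graph ℓ → Set ℓ
Connected G = V G × (∀ u v → Graph.Path G u v)

-- A system of paths is a family indexed by an arbitrary type.  As its paths
-- have distinct endvertices, edge-disjointness prevents repetitions in it.
record Join {ℓ} (G : Graph ℓ) (T : Pred (V G) ℓ) : Set (suc ℓ) where
  open Graph G using (Path; pathEdges)
  field
    Index         : Set ℓ
    source        : Index → V G
    target        : Index → V G
    path          : ∀ i → Path (source i) (target i)
    edge-disjoint : ∀ {i j} → i ≢ j →
                    Disjoint (pathEdges (path i)) (pathEdges (path j))
    distinct-ends : ∀ i → source i ≢ target i
    source∈T      : ∀ i → source i ∈ T
    target∈T      : ∀ i → target i ∈ T
    covers-once   : ∀ {v} → v ∈ T → ∃! _≡_ (λ i → v ≡ source i ⊎ v ≡ target i)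

infixl 7 _△_
_△_ : ∀ {a ℓ} {A : Set a} → Pred A ℓ → Pred A ℓ → Pred A ℓ
T′ △ T = (T ∖ T′) ∪ (T′ ∖ T)

-- Counting via a duplicate-free list rather than via ∃ S, which would count
-- an element once for every proof of membership.
HasSize : ∀ {a ℓ} {A : Set a} → Pred A ℓ → ℕ → Set _
HasSize S n = ∃[ xs ] Unique xs × length xs ≡ n × (∀ x → x ∈ S ⇔ x ∈ˡ xs)

Finite : ∀ {a ℓ} {A : Set a} → Pred A ℓ → Set _
Finite S = ∃[ n ] HasSize S n

module _ {ℓ} (G : Graph ℓ) (T : Pred (V G) ℓ) where

  PropertyA : Set (suc ℓ)
  PropertyA = ∀ (T′ : Pred (V G) ℓ) → Finite (T′ △ T) → Join G T′

  PropertyB : Set (suc ℓ)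
  PropertyB = ∀ (T′ : Pred (V G) ℓ) n → HasSize (T′ △ T) n →
              (2 ∣ n → Join G T′) × (2 ∤ n → ¬ Join G T′)

  PropertyC : Set (suc ℓ)
  PropertyC = ∀ (T′ : Pred (V G) ℓ) n → HasSize (T′ △ T) n →
              (2 ∤ n → Join G T′) × (2 ∣ n → ¬ Join G T′)

ExactlyOne : ∀ {a b c} → Set a → Set b → Set c → Set _
ExactlyOne X Y Z =
  (X × ¬ Y × ¬ Z) ⊎ (¬ X × Y × ¬ Z) ⊎ (¬ X × ¬ Y × Z)

SomePairSatisfies : ∀ ℓ → ((G : Graph ℓ) → Pred (V G) ℓ → Set (suc ℓ)) → Set (suc ℓ)
SomePairSatisfies ℓ P =
  ∃[ G ] Connected G × (∃[ T ] P G T)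

{-# OPTIONS --safe #-}
-- Write T ⊕ v for T with the membership of v toggled.  Everything follows from
--   (1) G has a (T ⊕ v)-join whenever it has no T-join, and
--   (2) G has a (T ⊕ u ⊕ v)-join whenever it has a T-join.
-- For (1), take a breadth-first spanning tree rooted at v.  A choice of tree
-- edges yields a join of T or of T ⊕ v as soon as at each vertex the incident
-- chosen edges, together with the vertex itself if it lies in T, are perfectly
-- matched, and each chosen edge leads down along matched edges to T in finitely
-- many steps.  Call a vertex bad if there is no such choice below it.  A bad
-- vertex has a bad child.  In the tree of bad vertices, which has no leaves,
-- every demand can be handed down to the first vertex where a token is
-- available, after which the surplus is absorbed by a bad child: so there are no
-- bad vertices at all.
-- For (2), take the union of a u-v path with the finitely many paths of the join
-- that it touches, and apply (1) there: parity excludes the unwanted alternative.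
module Submission where

open import Defs
open import Axiom.ExcludedMiddle using (ExcludedMiddle)
open import Axiom.Extensionality.Propositional using (Extensionality)
open import Axiom.UniquenessOfIdentityProofs.WithK using (uip)
open import Data.Bool.Base using (Bool; true; false; _∨_; not; _xor_)
open import Data.Bool.Properties
  using (∨-zeroʳ; not-involutive; not-injective; xor-assoc; xor-comm; xor-same; xor-identityʳ)
open import Data.Empty using (⊥; ⊥-elim)
open import Data.List.Base using (List; []; _∷_; length; _++_)
open import Data.List.Membership.Propositional using () renaming (_∈_ to _∈ˡ_)
open import Data.List.Membership.Propositional.Properties using (∈-++⁺ˡ; ∈-++⁺ʳ)
open import Data.List.Relation.Unary.All using ([]; _∷_)
open import Data.List.Relation.Unary.All.Properties using (¬Any⇒All¬; All¬⇒¬Any)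
open import Data.List.Relation.Unary.AllPairs using ([]; _∷_)
open import Data.List.Relation.Unary.Any using (here; there)
open import Data.List.Relation.Unary.Unique.Propositional using (Unique)
open import Data.Maybe.Base using (Maybe; just; nothing; maybe′)
open import Data.Maybe.Properties using (just-injective)
open import Data.Nat.Base using (ℕ; zero; suc; _<_; _≤_; z≤n; s≤s)
open import Data.Nat.Divisibility using (_∣_; _∤_; divides; ∣m+n∣m⇒∣n; ∣-refl; _∣0; ∣m∣n⇒∣m+n)
open import Data.Nat.Induction using (<-wellFounded)
open import Data.Nat.Properties
  using (suc-injective; ≤-refl; n≤1+n; <-asym; <-≤-trans; ≤-<-trans; <-cmp; m≤n⇒m<n∨m≡n)
open import Data.Product using (_×_; _,_; proj₁; proj₂; ∃; ∃!; Σ)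
open import Data.Sum.Base using (_⊎_; inj₁; inj₂; [_,_]′) renaming (swap to ⊎-swap)
open import Data.Unit.Base using (⊤; tt)
open import Function.Bundles using (_⇔_; mk⇔; Equivalence)
open import Induction.WellFounded using (Acc; acc)
open import Level using (Level; Lift; lift; lower)
open import Relation.Binary.Definitions using (tri<; tri≈; tri>)
open import Relation.Binary.PropositionalEquality
  using (_≡_; _≢_; refl; sym; trans; cong; cong₂; subst; ≢-sym)
open import Relation.Nullary using (¬_; Dec; yes; no; does; contradiction)
open import Relation.Unary using (Pred; _∈_)

-- The obstacle is infinity. An infinite tree has no leaves to begin from, and along a ray a parity
-- defect could be pushed on for ever. Admissible choices below a vertex are therefore defined
-- coinductively, and each used edge carries a natural number that strictly falls on the way down,
-- so that no path comes up from infinity; on the way up, the depth does the same work. Vertices of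
-- infinite degree need no separate treatment: any set whatsoever has a perfect matching, possibly
-- after one more element is added, and this single spare element is what parity amounts to at a
-- vertex. The maximality argument behind this needs the axiom of choice, which is available because
-- excluded middle is assumed for all types and so hands out a witness whenever there is one.

module Classical (em : ∀ {a} → ExcludedMiddle a) (ext : ∀ {a b} → Extensionality a b) where

  -- Boolean subsets and classical decisions

  private variable
    a b ℓ p q : Level
    A B : Set a

  -- With excluded middle at every level, a proposition of any size becomes a Boolean. Subsets of
  -- `A` thus stay in the universe of `A`, and their membership proofs are unique.
  ⌊_⌋ : Set a → Bool
  ⌊ P ⌋ = does (em {P = P})

  sound : {P : Set a} → ⌊ P ⌋ ≡ true → P
  sound {P = P} eq with em {P = P} | eq
  ... | yes x | _  = x
  ... | no _  | ()

  complete : {P : Set a} → P → ⌊ P ⌋ ≡ true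
  complete {P = P} x with em {P = P}
  ... | yes _ = refl
  ... | no ¬x = contradiction x ¬x

  complete⁻ : {P : Set a} → ¬ P → ⌊ P ⌋ ≡ false
  complete⁻ {P = P} ¬x with em {P = P}
  ... | yes x = contradiction x ¬x
  ... | no _  = refl

  decide : (P : Set a) → Dec P
  decide P = em

  Subset : Set a → Set a
  Subset A = A → Bool

  infix 4 _⊆_
  _⊆_ : Subset A → Subset A → Set _
  S ⊆ R = ∀ x → S x ≡ true → R x ≡ true

  ⊆-antisym : {S R : Subset A} → S ⊆ R → R ⊆ S → S ≡ R
  ⊆-antisym {S = S} {R} S⊆R R⊆S = ext λ x → go (S⊆R x) (R⊆S x)
    where
    go : {b c : Bool} → (b ≡ true → c ≡ true) → (c ≡ true → b ≡ true) → b ≡ c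
    go {true}  f g = sym (f refl)
    go {false} {true}  f g = g refl
    go {false} {false} f g = refl

  -- Maximal cliques

  -- Zermelo's tower argument: the subsets generated from below by adjoining a
  -- chosen compatible element and by taking unions form a chain.
  module MaximalClique {X : Set a} (C : X → X → Set p) where

    Clique : Subset X → Set _
    Clique S = ∀ {x y} → S x ≡ true → S y ≡ true → C x y

    Compatible : Subset X → X → Set _
    Compatible S x = C x x × (∀ {y} → S y ≡ true → C x y × C y x)

    New : Subset X → X → Set _
    New S x = S x ≡ false × Compatible S x

    extend : (S : Subset X) → Dec (∃ (New S)) → Subset X
    extend S (yes (x , _)) y = S y ∨ ⌊ y ≡ x ⌋
    extend S (no _)        y = S y

    -- The witness found by `em` depends on `S` alone: this is the choice function of the argument.
    next : Subset X → Subset X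
    next S = extend S em

    ⋃ : (Subset X → Bool) → Subset X
    ⋃ F x = ⌊ (∃ λ S → F S ≡ true × S x ≡ true) ⌋

    -- The empty subset enters as the union of the empty family, so there is no base constructor.
    data Tower : Subset X → Set a where
      step  : ∀ {S} → Tower S → Tower (next S)
      union : (F : Subset X → Bool) → (∀ S → F S ≡ true → Tower S) → Tower (⋃ F)

    ⊆-extend : ∀ S d → S ⊆ extend S d
    ⊆-extend S (yes _) y Sy rewrite Sy = refl
    ⊆-extend S (no _)  y Sy = Sy

    extend-clique : ∀ S d y z → Clique S → extend S d y ≡ true → extend S d z ≡ true → C y z
    extend-clique S (no _) y z cl e f = cl e f
    extend-clique S (yes (x , _ , cx , c)) y z cl e f with S y in Sy | S z in Sz
    ... | true  | true  = cl Sy Sz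
    ... | true  | false with refl ← sound {P = z ≡ x} f = proj₂ (c Sy)
    ... | false | true  with refl ← sound {P = y ≡ x} e = proj₁ (c Sz)
    ... | false | false with refl ← sound {P = y ≡ x} e | refl ← sound {P = z ≡ x} f = cx

    -- Comparability is strengthened so that nothing in the tower lies strictly between `R` and
    -- `next R`; this makes a double induction work. When two sets include each other,
    -- extensionality makes them equal, and `next` then agrees on them.
    compare : ∀ {S R} → Tower S → Tower R → S ⊆ R ⊎ next R ⊆ S
    compare {R = R} (union F h) t with decide (∃ λ S → F S ≡ true × next R ⊆ S)
    ... | yes (S , FS , R⊆S) = inj₂ λ x Rx → complete (S , FS , R⊆S x Rx)
    ... | no none = inj₁ below
      where
      below : ⋃ F ⊆ R
      below x Ux with S , FS , Sx ← sound Ux with compare (h S FS) t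
      ... | inj₁ S⊆R = S⊆R x Sx
      ... | inj₂ R⊆S = contradiction (S , FS , R⊆S) none
    compare {R = R} (step {S} s) t with compare s t
    ... | inj₂ R⊆S = inj₂ λ x Rx → ⊆-extend S em x (R⊆S x Rx)
    ... | inj₁ S⊆R with compare t s
    ...   | inj₂ S⁺⊆R = inj₁ S⁺⊆R
    ...   | inj₁ R⊆S  = inj₂ (subst (λ Q → next Q ⊆ next S) (⊆-antisym S⊆R R⊆S) λ _ e → e)

    tower-clique : ∀ {S} → Tower S → Clique S
    tower-clique (step {S} s) {x} {y} = extend-clique S em x y (tower-clique s)
    tower-clique (union F h) {x} {y} Ux Uy
      with S , FS , Sx ← sound Ux | R , FR , Ry ← sound Uy
      with compare (h S FS) (h R FR)
    ... | inj₁ S⊆R = tower-clique (h R FR) (S⊆R x Sx) Ry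
    ... | inj₂ R⊆S = tower-clique (h S FS) Sx (R⊆S y (⊆-extend R em y Ry))

    -- The union of the whole tower is itself in the tower, hence so is its `next`, which is
    -- therefore contained in it: no compatible element was left to adjoin.
    maximal-clique : ∃ λ S → Clique S × (∀ x → Compatible S x → S x ≡ true)
    maximal-clique = U , tower-clique U-tower , maximal em (next⊆U)
      where
      U : Subset X
      U = ⋃ λ S → ⌊ Tower S ⌋

      U-tower : Tower U
      U-tower = union _ λ _ → sound

      next⊆U : next U ⊆ U
      next⊆U x e = complete (next U , complete (step U-tower) , e)

      maximal : (d : Dec (∃ (New U))) → extend U d ⊆ U → ∀ x → Compatible U x → U x ≡ true
      maximal (no none) _ x c with U x in Ux
      ... | true  = refl
      ... | false = contradiction (x , Ux , c) none
      maximal (yes (y , y∉U , _)) sub = contradiction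
        (trans (sym y∉U) (sub y (trans (cong (U y ∨_) (complete refl)) (∨-zeroʳ (U y))))) λ ()

  -- Perfect matchings, as fixed-point-free involutions

  Perfect : Pred A p → (A → A) → Set _
  Perfect P μ = ∀ {x} → P x → P (μ x) × μ (μ x) ≡ x × μ x ≢ x

  perfect-⇔ : {P : Pred A p} {Q : Pred A q} {μ : A → A} →
              (∀ {x} → P x → Q x) → (∀ {x} → Q x → P x) → Perfect P μ → Perfect Q μ
  perfect-⇔ P⇒Q Q⇒P perfect Qx with Pμx , rest ← perfect (Q⇒P Qx) = P⇒Q Pμx , rest

  perfect-injective : {P : Pred A p} {μ : A → A} → Perfect P μ →
                      ∀ {x y} → P x → P y → μ x ≡ μ y → x ≡ y
  perfect-injective {μ = μ} perfect Px Py e =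
    trans (sym (proj₁ (proj₂ (perfect Px)))) (trans (cong μ e) (proj₁ (proj₂ (perfect Py))))

  relation⇒perfect : {P : Pred A p} (R : A → A → Set q) →
    (∀ {x y} → R x y → R y x) → (∀ {x} → ¬ R x x) →
    (∀ {x y z} → R x y → R x z → y ≡ z) → (∀ {x y} → R x y → P x) →
    (∀ {x} → P x → ∃ λ y → R x y) →
    ∃ λ μ → Perfect P μ × (∀ {x} → P x → R x (μ x))
  relation⇒perfect {A = A} {P = P} R R-sym R-irrefl R-fun R-in R-total = μ , perfect , μ-R
    where
    pick : ∀ x → Dec (∃ λ y → R x y) → A
    pick x (yes (y , _)) = y
    pick x (no _)        = x

    pick-R : ∀ {x} d → P x → R x (pick x d)
    pick-R (yes (_ , r)) Px = r
    pick-R (no none)     Px = contradiction (R-total Px) none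

    μ : A → A
    μ x = pick x em

    μ-R : ∀ {x} → P x → R x (μ x)
    μ-R = pick-R em

    perfect : Perfect P μ
    perfect {x} Px = Pμ , R-fun (μ-R Pμ) (R-sym xμx) , λ e → R-irrefl (subst (R x) e xμx)
      where
      xμx = μ-R Px
      Pμ  = R-in (R-sym xμx)

  -- The new matching is `μ` conjugated by the transposition of `v` and `μ u`, which fixes `u`.
  rematch : {P : Pred A p} {μ : A → A} → Perfect P μ → ∀ {u v} → P u → P v → u ≢ v →
            ∃ λ μ′ → Perfect P μ′ × μ′ u ≡ v
  rematch {A = A} {P = P} {μ} perfect {u} {v} Pu Pv u≢v = μ′ , perfect′ , μ′u
    where
    w = μ u

    swap′ : ∀ x → Dec (x ≡ v) → Dec (x ≡ w) → A
    swap′ x (yes _) _       = w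
    swap′ x (no _)  (yes _) = v
    swap′ x (no _)  (no _)  = x

    swap : A → A
    swap x = swap′ x em em

    swap-w : ∀ d e → swap′ w d e ≡ v
    swap-w (yes w≡v) _       = w≡v
    swap-w (no _)    (yes _) = refl
    swap-w (no _)    (no f)  = contradiction refl f

    swap-v : ∀ d e → swap′ v d e ≡ w
    swap-v (yes _) _ = refl
    swap-v (no f)  _ = contradiction refl f

    swap-fix : ∀ {x} d e → x ≢ v → x ≢ w → swap′ x d e ≡ x
    swap-fix (yes e) _       ≢v ≢w = contradiction e ≢v
    swap-fix (no _)  (yes e) ≢v ≢w = contradiction e ≢w
    swap-fix (no _)  (no _)  ≢v ≢w = refl

    swap-involutive′ : ∀ x d e → swap (swap′ x d e) ≡ x
    swap-involutive′ x (yes refl) _          = swap-w em em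
    swap-involutive′ x (no _)     (yes refl) = swap-v em em
    swap-involutive′ x (no f)     (no g)     = swap-fix em em f g

    swap-involutive : ∀ x → swap (swap x) ≡ x
    swap-involutive x = swap-involutive′ x em em

    swap-P : ∀ {x} d e → P x → P (swap′ x d e)
    swap-P (yes _) _       _  = proj₁ (perfect Pu)
    swap-P (no _)  (yes _) _  = Pv
    swap-P (no _)  (no _)  Px = Px

    μ′ : A → A
    μ′ x = swap (μ (swap x))

    perfect′ : Perfect P μ′
    perfect′ {x} Px with Pμy , μμy , μy≢y ← perfect (swap-P em em Px) =
      swap-P em em Pμy ,
      trans (cong (λ y → swap (μ y)) (swap-involutive _))
            (trans (cong swap μμy) (swap-involutive x)) ,
      λ e → μy≢y (trans (sym (swap-involutive _)) (cong swap e))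

    μ′u : μ′ u ≡ v
    μ′u = trans (cong (λ y → swap (μ y)) (swap-fix em em u≢v λ e → proj₂ (proj₂ (perfect Pu)) (sym e)))
                (swap-w em em)

  module PartialMatching {a p} {A : Set a} (P : Pred A p) where

    -- Partial matchings are the cliques of this relation on pairs, so a maximal one exists. `same`
    -- is there because a clique also compares each pair with itself.
    data Apart : A × A → A × A → Set a where
      same  : ∀ {e} → Apart e e
      apart : ∀ {x y x′ y′} → x ≢ x′ → x ≢ y′ → y ≢ x′ → y ≢ y′ → Apart (x , y) (x′ , y′)

    Edge : A × A → Set _
    Edge (x , y) = P x × P y × x ≢ y

    open MaximalClique (λ e f → Edge e × Edge f × Apart e f)

    M = proj₁ maximal-clique

    clique : Clique M
    clique = proj₁ (proj₂ maximal-clique)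

    data R : A → A → Set a where
      fwd : ∀ {x y} → M (x , y) ≡ true → R x y
      bwd : ∀ {x y} → M (x , y) ≡ true → R y x

    R-sym : ∀ {x y} → R x y → R y x
    R-sym (fwd m) = bwd m
    R-sym (bwd m) = fwd m

    R-in : ∀ {x y} → R x y → P x
    R-in (fwd m) = proj₁ (proj₁ (clique m m))
    R-in (bwd m) = proj₁ (proj₂ (proj₁ (clique m m)))

    R-irrefl : ∀ {x} → ¬ R x x
    R-irrefl (fwd m) = proj₂ (proj₂ (proj₁ (clique m m))) refl
    R-irrefl (bwd m) = proj₂ (proj₂ (proj₁ (clique m m))) refl

    R-fun : ∀ {x y z} → R x y → R x z → y ≡ z
    R-fun (fwd m) (fwd n) with proj₂ (proj₂ (clique m n))
    ... | same = refl
    ... | apart f _ _ _ = contradiction refl f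
    R-fun (fwd m) (bwd n) with proj₂ (proj₂ (clique m n))
    ... | same = refl
    ... | apart _ f _ _ = contradiction refl f
    R-fun (bwd m) (fwd n) with proj₂ (proj₂ (clique m n))
    ... | same = refl
    ... | apart _ _ f _ = contradiction refl f
    R-fun (bwd m) (bwd n) with proj₂ (proj₂ (clique m n))
    ... | same = refl
    ... | apart _ _ _ f = contradiction refl f

    Unmatched : A → Set _
    Unmatched x = P x × (∀ y → ¬ R x y)

    -- Two distinct unmatched elements would form a pair that is compatible with the maximal
    -- matching.
    at-most-one : ∀ {x y} → Unmatched x → Unmatched y → x ≡ y
    at-most-one {x} {y} (Px , free-x) (Py , free-y) with decide (x ≡ y)
    ... | yes e = e
    ... | no x≢y = contradiction (fwd (proj₂ (proj₂ maximal-clique) (x , y) compatible)) (free-x y)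
      where
      edge : Edge (x , y)
      edge = Px , Py , x≢y

      compatible : Compatible M (x , y)
      compatible = (edge , edge , same) , λ {(x′ , y′)} m →
        let edge′ = proj₁ (clique m m)
            f₁ : x ≢ x′
            f₁ = λ { refl → free-x _ (fwd m) }
            f₂ : x ≢ y′
            f₂ = λ { refl → free-x _ (bwd m) }
            f₃ : y ≢ x′
            f₃ = λ { refl → free-y _ (fwd m) }
            f₄ : y ≢ y′
            f₄ = λ { refl → free-y _ (bwd m) }
        in (edge , edge′ , apart f₁ f₂ f₃ f₄) ,
           (edge′ , edge , apart (≢-sym f₁) (≢-sym f₃) (≢-sym f₂) (≢-sym f₄))

    matched : ¬ ∃ Unmatched → ∃ (Perfect P)
    matched none = _ , proj₁ (proj₂ (relation⇒perfect R R-sym R-irrefl R-fun R-in R-total))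
      where
      R-total : ∀ {x} → P x → ∃ λ y → R x y
      R-total {x} Px with decide (∃ λ y → R x y)
      ... | yes r = r
      ... | no f = contradiction (x , Px , λ y r → f (y , r)) none

    module _ {z u} (z∉P : ¬ P z) (Pu : P u) (free : ∀ y → ¬ R u y) where

      data R′ : A → A → Set a where
        old : ∀ {x y} → R x y → R′ x y
        u-z : R′ u z
        z-u : R′ z u

      R′-sym : ∀ {x y} → R′ x y → R′ y x
      R′-sym (old r) = old (R-sym r)
      R′-sym u-z     = z-u
      R′-sym z-u     = u-z

      u≢z : u ≢ z
      u≢z refl = z∉P Pu

      R′-irrefl : ∀ {x} → ¬ R′ x x
      R′-irrefl r = go r refl
        where
        go : ∀ {x y} → R′ x y → x ≢ y
        go (old r) refl = R-irrefl r
        go u-z     e    = u≢z e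
        go z-u     e    = u≢z (sym e)

      R′-fun′ : ∀ {x x′ y y′} → R′ x y → R′ x′ y′ → x ≡ x′ → y ≡ y′
      R′-fun′ (old r) (old s) refl = R-fun r s
      R′-fun′ (old r) u-z     refl = contradiction r (free _)
      R′-fun′ (old r) z-u     refl = contradiction (R-in r) z∉P
      R′-fun′ u-z     (old s) refl = contradiction s (free _)
      R′-fun′ u-z     u-z     e    = refl
      R′-fun′ u-z     z-u     e    = contradiction e u≢z
      R′-fun′ z-u     (old s) refl = contradiction (R-in s) z∉P
      R′-fun′ z-u     u-z     e    = contradiction (sym e) u≢z
      R′-fun′ z-u     z-u     e    = refl

      R′-fun : ∀ {x y z} → R′ x y → R′ x z → y ≡ z
      R′-fun r s = R′-fun′ r s refl

      R′-in : ∀ {x y} → R′ x y → P x ⊎ x ≡ z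
      R′-in (old r) = inj₁ (R-in r)
      R′-in u-z     = inj₁ Pu
      R′-in z-u     = inj₂ refl

      R′-total : ∀ {x} → P x ⊎ x ≡ z → ∃ λ y → R′ x y
      R′-total (inj₂ refl) = u , z-u
      R′-total {x} (inj₁ Px) with decide (∃ λ y → R x y)
      ... | yes (y , r) = y , old r
      ... | no f with refl ← at-most-one (Px , λ y r → f (y , r)) (Pu , free) = z , u-z

      matched-with-extra : ∃ (Perfect λ x → P x ⊎ x ≡ z)
      matched-with-extra = _ , proj₁ (proj₂
        (relation⇒perfect R′ R′-sym R′-irrefl R′-fun R′-in R′-total))

  -- A maximal partial matching of P misses at most one element, which can be
  -- matched with z.
  match-up-to-one : (P : Pred A p) (z : A) → ¬ P z →
    ∃ (Perfect P) ⊎ ∃ (Perfect λ x → P x ⊎ x ≡ z)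
  match-up-to-one P z z∉P with decide (∃ (PartialMatching.Unmatched P))
  ... | no none             = inj₁ (PartialMatching.matched P none)
  ... | yes (u , Pu , free) = inj₂ (PartialMatching.matched-with-extra P z∉P Pu free)

  -- Toggling elements, and the parity of finite sets

  infixl 6 _⊕_
  _⊕_ : Subset A → A → Subset A
  (S ⊕ v) x = S x xor ⌊ x ≡ v ⌋

  ⊕-cancel : (S : Subset A) (v : A) → S ⊕ v ⊕ v ≡ S
  ⊕-cancel S v = ext λ x → trans (xor-assoc (S x) _ _)
    (trans (cong (S x xor_) (xor-same ⌊ x ≡ v ⌋)) (xor-identityʳ (S x)))

  ⊕-comm : (S : Subset A) (u v : A) → S ⊕ u ⊕ v ≡ S ⊕ v ⊕ u
  ⊕-comm S u v = ext λ x → trans (xor-assoc (S x) _ _)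
    (trans (cong (S x xor_) (xor-comm ⌊ x ≡ u ⌋ ⌊ x ≡ v ⌋)) (sym (xor-assoc (S x) _ _)))

  infixl 6 _⊕⋆_
  _⊕⋆_ : Subset A → List A → Subset A
  S ⊕⋆ []       = S
  S ⊕⋆ (x ∷ xs) = (S ⊕⋆ xs) ⊕ x

  ⊕⋆-⊕ : (S : Subset A) (xs : List A) (v : A) → S ⊕⋆ xs ⊕ v ≡ S ⊕ v ⊕⋆ xs
  ⊕⋆-⊕ S []       v = refl
  ⊕⋆-⊕ S (x ∷ xs) v = trans (⊕-comm (S ⊕⋆ xs) x v) (cong (_⊕ x) (⊕⋆-⊕ S xs v))

  ⊕⋆-cancel : (S : Subset A) (xs : List A) → S ⊕⋆ xs ⊕⋆ xs ≡ S
  ⊕⋆-cancel S []       = refl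
  ⊕⋆-cancel S (x ∷ xs) = trans (cong (_⊕ x) (sym (⊕⋆-⊕ (S ⊕⋆ xs) xs x)))
    (trans (⊕-cancel (S ⊕⋆ xs ⊕⋆ xs) x) (⊕⋆-cancel S xs))

  odd : List A → Bool
  odd []       = false
  odd (_ ∷ xs) = not (odd xs)

  ⊕-same : (S : Subset A) (v : A) → (S ⊕ v) v ≡ not (S v)
  ⊕-same S v = trans (cong (S v xor_) (complete refl)) (xor-comm (S v) true)

  ⊕-other : (S : Subset A) {x v : A} → x ≢ v → (S ⊕ v) x ≡ S x
  ⊕-other S {x} {v} x≢v with decide (x ≡ v)
  ... | yes e = contradiction e x≢v
  ... | no _  = xor-identityʳ (S x)

  ∅ : Subset A
  ∅ _ = false

  ∈-toggles : (xs : List A) {v : A} → (∅ ⊕⋆ xs) v ≡ true → v ∈ˡ xs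
  ∈-toggles (x ∷ xs) {v} e with decide (v ≡ x)
  ... | yes v≡x = here v≡x
  ... | no v≢x  = there (∈-toggles xs (trans (sym (xor-identityʳ _)) e))

  remove : {xs : List A} {v : A} → v ∈ˡ xs →
           ∃ λ ys → length xs ≡ suc (length ys) × odd xs ≡ not (odd ys) × ∅ ⊕⋆ xs ≡ ∅ ⊕⋆ ys ⊕ v
  remove {xs = x ∷ xs} (here refl) = xs , refl , refl , refl
  remove {xs = x ∷ xs} {v} (there m) with ys , l , o , e ← remove m =
    x ∷ ys , cong suc l , cong not o , trans (cong (_⊕ x) e) (⊕-comm (∅ ⊕⋆ ys) v x)

  -- The list is only a bound for `S`. If its head lies in `S`, toggling takes the head out of `S`,
  -- and the tail bounds what remains.
  finite⇒toggles : (S : Subset A) (xs : List A) → (∀ {x} → S x ≡ true → x ∈ˡ xs) →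
                   ∃ λ ys → S ≡ ∅ ⊕⋆ ys
  finite⇒toggles S [] sub = [] , ext λ x → go x
    where
    go : ∀ x → S x ≡ false
    go x with S x in e
    ... | false = refl
    ... | true with () ← sub e
  finite⇒toggles S (x ∷ xs) sub with S x in Sx
  ... | false = finite⇒toggles S xs λ {y} Sy → smaller (sub Sy) Sy
    where
    smaller : ∀ {y} → y ∈ˡ x ∷ xs → S y ≡ true → y ∈ˡ xs
    smaller (here refl) Sy = contradiction (trans (sym Sx) Sy) λ ()
    smaller (there m)   Sy = m
  ... | true = let ys , e = finite⇒toggles (S ⊕ x) xs (λ {y} Sy → smaller Sy) in
    x ∷ ys , trans (sym (⊕-cancel S x)) (cong (_⊕ x) e)
    where
    smaller : ∀ {y} → (S ⊕ x) y ≡ true → y ∈ˡ xs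
    smaller {y} Sy with decide (y ≡ x)
    ... | yes refl = contradiction (trans (sym (cong not Sx)) (trans (xor-comm true (S x)) Sy)) λ ()
    ... | no y≢x with sub (trans (sym (xor-identityʳ _)) Sy)
    ...   | here e  = contradiction e y≢x
    ...   | there m = m

  remove-pair : {S : Subset A} {μ : A → A} → Perfect (λ y → S y ≡ true) μ →
                ∀ {x} → S x ≡ true → Perfect (λ y → (S ⊕ x ⊕ μ x) y ≡ true) μ
  remove-pair {S = S} {μ} perfect {x} Sx = perfect′
    where
    Sμx = proj₁ (perfect Sx)
    μμx = proj₁ (proj₂ (perfect Sx))
    μx≢x = proj₂ (proj₂ (perfect Sx))

    from : ∀ {y} → (S ⊕ x ⊕ μ x) y ≡ true → S y ≡ true × y ≢ x × y ≢ μ x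
    from {y} e = go (decide (y ≡ μ x)) (decide (y ≡ x))
      where
      go : Dec (y ≡ μ x) → Dec (y ≡ x) → S y ≡ true × y ≢ x × y ≢ μ x
      go (yes refl) _ = contradiction
        (trans (sym e) (trans (⊕-same (S ⊕ x) y) (cong not (trans (⊕-other S μx≢x) Sμx)))) λ ()
      go (no y≢μx) (yes refl) = contradiction
        (trans (sym e) (trans (⊕-other (S ⊕ x) y≢μx) (trans (⊕-same S x) (cong not Sx)))) λ ()
      go (no y≢μx) (no y≢x) = trans (sym (trans (⊕-other (S ⊕ x) y≢μx) (⊕-other S y≢x))) e , y≢x , y≢μx

    perfect′ : Perfect (λ y → (S ⊕ x ⊕ μ x) y ≡ true) μ
    perfect′ {y} e with Sy , y≢x , y≢μx ← from e with Sμy , rest ← perfect Sy =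
      trans (trans (⊕-other (S ⊕ x) λ f → y≢x (perfect-injective perfect Sy Sx f))
                   (⊕-other S λ f → y≢μx (trans (sym (proj₁ rest)) (cong μ f)))) Sμy , rest

  -- Entries may repeat, hence the induction on the length. If the head `x` lies in the set, `x` and
  -- `μ x` are removed together; otherwise `x` occurs again in the tail and the two occurrences
  -- cancel. Either way two entries go.
  perfect⇒even : (xs : List A) {μ : A → A} → Perfect (λ x → (∅ ⊕⋆ xs) x ≡ true) μ → odd xs ≡ false
  perfect⇒even {A = A} xs = go xs (<-wellFounded (length xs))
    where
    go : (xs : List A) {μ : A → A} → Acc _<_ (length xs) →
         Perfect (λ x → (∅ ⊕⋆ xs) x ≡ true) μ → odd xs ≡ false
    go [] _ _ = refl
    go (x ∷ xs) {μ} (acc rec) perfect with (∅ ⊕⋆ (x ∷ xs)) x in e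
    ... | true with ys , l , o , f ← remove (∈-toggles xs {μ x}
                 (trans (sym (⊕-other (∅ ⊕⋆ xs) (proj₂ (proj₂ (perfect e))))) (proj₁ (perfect e))))
      = trans (cong not o) (trans (not-involutive _)
          (go ys (rec (s≤s (subst (length ys ≤_) (sym l) (n≤1+n _))))
            (subst (λ S → Perfect (λ y → S y ≡ true) μ) g
              (remove-pair {S = ∅ ⊕⋆ xs ⊕ x} perfect e))))
      where
      g : ∅ ⊕⋆ xs ⊕ x ⊕ x ⊕ μ x ≡ ∅ ⊕⋆ ys
      g = trans (cong (_⊕ μ x) (trans (⊕-cancel (∅ ⊕⋆ xs) x) f)) (⊕-cancel (∅ ⊕⋆ ys) (μ x))
    go (x ∷ xs) {μ} (acc rec) perfect | false with ys , l , o , f ← remove (∈-toggles xs {x}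
                 (not-injective (trans (sym (⊕-same (∅ ⊕⋆ xs) x)) e)))
      = trans (cong not o) (trans (not-involutive _)
          (go ys (rec (s≤s (subst (length ys ≤_) (sym l) (n≤1+n _))))
            (subst (λ S → Perfect (λ y → S y ≡ true) μ)
              (trans (cong (_⊕ x) f) (⊕-cancel (∅ ⊕⋆ ys) x)) (λ {y} → perfect {y}))))

  -- Routing tokens in a rooted tree

  module Forest {ℓ} {V : Set ℓ} (r : V) (N : V → Set ℓ) (parent : V → V) (depth : V → ℕ)
    (depth-parent : ∀ {x} → N x → depth (parent x) < depth x)
    (N-parent : ∀ {x} → N x → parent x ≡ r ⊎ N (parent x))
    (r∉N : ¬ N r)
    (T : Subset V) (T-in : ∀ {x} → T x ≡ true → x ≡ r ⊎ N x)
    where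

    -- The state of a vertex says whether the edge to its parent is used; just n
    -- promises that a vertex of T is reached from it downwards in at most n used edges.
    State : Set
    State = Maybe ℕ

    Child : V → V → Set ℓ
    Child c x = N c × parent c ≡ x

    data Token : Set ℓ where
      own up : Token
      from   : V → Token

    data Active (t : Bool) (x : V) (s : State) (σ : V → State) : Token → Set ℓ where
      own  : t ≡ true → Active t x s σ own
      up   : ∀ {n} → s ≡ just n → Active t x s σ up
      from : ∀ {c n} → Child c x → σ c ≡ just n → Active t x s σ (from c)

    -- The strict inequality is what makes tracing a token downwards terminate: from an edge with
    -- promise `n`, the matched edge below has a smaller promise, until a vertex of `T` is met.
    data Source (x : V) (σ : V → State) (n : ℕ) : Token → Set ℓ where
      own  : Source x σ n own
      from : ∀ {c m} → Child c x → σ c ≡ just m → m < n → Source x σ n (from c)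

    record Rule (t : Bool) (x : V) (s : State) (σ : V → State) : Set ℓ where
      constructor rule
      field
        match   : Token → Token
        perfect : Perfect (Active t x s σ) match
        source  : ∀ {n} → s ≡ just n → Source x σ n (match up)

    active-cong : ∀ {t t′ x s σ σ′} → t ≡ t′ → (∀ {c} → Child c x → σ c ≡ σ′ c) →
                  ∀ {τ} → Active t x s σ τ → Active t′ x s σ′ τ
    active-cong t≡ σ≡ (own e)    = own (trans (sym t≡) e)
    active-cong t≡ σ≡ (up e)     = up e
    active-cong t≡ σ≡ (from c e) = from c (trans (sym (σ≡ c)) e)

    source-cong : ∀ {x σ σ′ n} → (∀ {c} → Child c x → σ c ≡ σ′ c) →
                  ∀ {τ} → Source x σ n τ → Source x σ′ n τ
    source-cong σ≡ own          = own
    source-cong σ≡ (from c e l) = from c (trans (sym (σ≡ c)) e) l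

    rule-cong : ∀ {t t′ x s σ σ′} → t ≡ t′ → (∀ {c} → Child c x → σ c ≡ σ′ c) →
                Rule t x s σ → Rule t′ x s σ′
    rule-cong t≡ σ≡ (rule μ perfect source) = rule μ
      (perfect-⇔ (active-cong t≡ σ≡) (active-cong (sym t≡) λ c → sym (σ≡ c)) perfect)
      λ e → source-cong σ≡ (source e)

    Closed : (V → State → Bool) → Set ℓ
    Closed Γ = ∀ {x s} → Γ x s ≡ true →
      ∃ λ σ → Rule (T x) x s σ × (∀ {c} → Child c x → Γ c (σ c) ≡ true)

    -- The greatest fixed point, taken as the union of all post-fixed points `Γ`, since the tree
    -- below `x` may be infinite. Boolean families keep it at level `ℓ`.
    Good : V → State → Set ℓ
    Good x s = ∃ λ Γ → Γ x s ≡ true × Closed Γ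

    unfold : ∀ {x s} → Good x s → ∃ λ σ → Rule (T x) x s σ × (∀ {c} → Child c x → Good c (σ c))
    unfold (Γ , e , closed) with σ , ρ , next ← closed e = σ , ρ , λ c → Γ , next c , closed

    -- Coinduction up to `Good`: a child may leave `Q` for a state already known to be good.
    coinduct : (Q : V → State → Set ℓ) →
      (∀ {x s} → Q x s → ∃ λ σ → Rule (T x) x s σ × (∀ {c} → Child c x → Q c (σ c) ⊎ Good c (σ c))) →
      ∀ {x s} → Q x s → Good x s
    coinduct Q expand q = Γ , complete (inj₁ q) , closed
      where
      Γ : V → State → Bool
      Γ x s = ⌊ Q x s ⊎ Good x s ⌋

      closed : Closed Γ
      closed {x} {s} e with sound {P = Q x s ⊎ Good x s} e
      ... | inj₁ q with σ , ρ , next ← expand q = σ , ρ , λ c → complete (next c)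
      ... | inj₂ g with σ , ρ , next ← unfold g = σ , ρ , λ c → complete (inj₂ (next c))

    good-step : ∀ {x s σ} → Rule (T x) x s σ → (∀ {c} → Child c x → Good c (σ c)) → Good x s
    good-step {x} {s} {σ} ρ good = coinduct (λ y u → y ≡ x × u ≡ s)
      (λ { (refl , refl) → σ , ρ , λ c → inj₂ (good c) }) (refl , refl)

    Bad : V → Set ℓ
    Bad x = ¬ ∃ (Good x)

    chosen′ : ∀ {x} → Dec (∃ (Good x)) → State
    chosen′ (yes (s , _)) = s
    chosen′ (no _)        = nothing

    chosen : V → State
    chosen x = chosen′ {x} em

    chosen-good : ∀ {x} → ¬ Bad x → Good x (chosen x)
    chosen-good {x} ¬bad = go em
      where
      go : (d : Dec (∃ (Good x))) → Good x (chosen′ d)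
      go (yes (_ , g)) = g
      go (no bad)      = contradiction bad ¬bad

    chosen-bad : ∀ {x} → Bad x → chosen x ≡ nothing
    chosen-bad {x} bad = go em
      where
      go : (d : Dec (∃ (Good x))) → chosen′ d ≡ nothing
      go (yes g) = contradiction g bad
      go (no _)  = refl

    no-token : ∀ {t x σ} → t ≡ false → (∀ {c n} → Child c x → σ c ≢ just n) → Rule t x nothing σ
    no-token t≡ none = rule (λ τ → τ)
      (λ { (own e)    → contradiction (trans (sym t≡) e) λ ()
         ; (up ())
         ; (from c e) → contradiction e (none c) })
      λ ()

    send-up : ∀ {t x σ τ n} → Active t x nothing σ τ ⊎ τ ≡ up → Active t x (just n) σ τ
    send-up (inj₁ (own e))    = own e
    send-up (inj₁ (up ()))
    send-up (inj₁ (from c e)) = from c e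
    send-up (inj₂ refl)       = up refl

    send-up⁻¹ : ∀ {t x σ τ n} → Active t x (just n) σ τ → Active t x nothing σ τ ⊎ τ ≡ up
    send-up⁻¹ (own e)    = inj₁ (own e)
    send-up⁻¹ (up _)     = inj₂ refl
    send-up⁻¹ (from c e) = inj₁ (from c e)

    -- If all children had good states, the tokens at `x` could be matched with `up` as the spare
    -- element, which would make `x` good. If `up` is used, its partner dictates the promise: 0 for
    -- the vertex itself, and one more than the promise of the child otherwise.
    bad-child : ∀ {x} → Bad x → ∃ λ c → Child c x × Bad c
    bad-child {x} bad with decide (∃ λ c → Child c x × Bad c)
    ... | yes e = e
    ... | no none with match-up-to-one (Active (T x) x nothing chosen) up (λ { (up ()) })
    ...   | inj₁ (μ , perfect) = contradiction
      (nothing , good-step (rule μ perfect λ ()) λ {c} ch → chosen-good λ b → none (c , ch , b)) bad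
    ...   | inj₂ (μ , perfect) with μ up in eq | perfect {up} (inj₂ refl)
    ...     | _ | inj₂ e , _ , ≢up = contradiction e ≢up
    ...     | _ | inj₁ (own e) , _ = contradiction
      (just 0 , good-step
        (rule μ (perfect-⇔ send-up send-up⁻¹ perfect) λ { refl → subst (Source _ _ _) (sym eq) own })
        λ {c} ch → chosen-good λ b → none (c , ch , b)) bad
    ...     | _ | inj₁ (from {n = m} d e) , _ = contradiction
      (just (suc m) , good-step
        (rule μ (perfect-⇔ send-up send-up⁻¹ perfect) λ { refl →
          subst (Source _ _ _) (sym eq) (from d e ≤-refl) })
        λ {c} ch → chosen-good λ b → none (c , ch , b)) bad

    -- A bound for fetching a token up through bad vertices. `via-bad` is restricted to vertices
    -- where no other token can be had, so that under `chosen` the fetched token is the only one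
    -- there and is simply passed on.
    data Reach : V → ℕ → Set ℓ where
      here     : ∀ {x n} → T x ≡ true → Reach x n
      via-good : ∀ {x n c m} → Child c x → Good c (just m) → m < n → Reach x n
      via-bad  : ∀ {x n c m} → T x ≡ false → (∀ {d k} → Child d x → ¬ Good d (just k)) →
                 Child c x → Bad c → Reach c m → m < n → Reach x n

    chosen-nothing : ∀ {x} → (∀ {d k} → Child d x → ¬ Good d (just k)) →
                     ∀ {c} → Child c x → chosen c ≡ nothing
    chosen-nothing none {c} ch with decide (Bad c)
    ... | yes b = chosen-bad b
    ... | no ¬b with chosen c | chosen-good ¬b
    ...   | nothing | _ = refl
    ...   | just _  | g = contradiction g (none ch)

    -- Otherwise choosing no edge would be admissible: an unreached bad vertex is not in `T`, its
    -- good children all have `nothing` chosen, and its bad children are again unreached. This would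
    -- make `x` good.
    reach : ∀ {x} → Bad x → ∃ (Reach x)
    reach {x} bad with decide (∃ (Reach x))
    ... | yes e = e
    ... | no none = contradiction (nothing , coinduct Q expand (refl , bad , none)) bad
      where
      Q : V → State → Set ℓ
      Q y s = s ≡ nothing × Bad y × ¬ ∃ (Reach y)

      expand : ∀ {y s} → Q y s →
               ∃ λ σ → Rule (T y) y s σ × (∀ {c} → Child c y → Q c (σ c) ⊎ Good c (σ c))
      expand {y} (refl , bad , unreached) = chosen ,
        no-token Ty (λ ch e → contradiction (trans (sym (chosen-nothing quiet ch)) e) λ ()) , next
        where
        Ty : T y ≡ false
        Ty with T y in e
        ... | true  = contradiction (0 , here e) unreached
        ... | false = refl

        quiet : ∀ {d k} → Child d y → ¬ Good d (just k)
        quiet ch g = unreached (_ , via-good ch g ≤-refl)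

        next : ∀ {c} → Child c y → Q c (chosen c) ⊎ Good c (chosen c)
        next {c} ch with decide (Bad c)
        ... | no ¬b = inj₂ (chosen-good ¬b)
        ... | yes b = inj₁ (chosen-bad b , b , λ (m , ρ) →
                unreached (suc m , via-bad Ty quiet ch b ρ ≤-refl))

    update′ : ∀ {c b} → (V → State) → State → Dec (c ≡ b) → State
    update′         σ v (yes _) = v
    update′ {c = c} σ v (no _)  = σ c

    abstract
      update : (V → State) → V → State → V → State
      update σ b v c = update′ {c} {b} σ v em

      update-same : ∀ {σ b v} → update σ b v b ≡ v
      update-same {σ} {b} {v} = go em
        where
        go : (d : Dec (b ≡ b)) → update′ σ v d ≡ v
        go (yes _) = refl
        go (no ¬e) = contradiction refl ¬e

      update-other : ∀ {σ b v c} → c ≢ b → update σ b v c ≡ σ c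
      update-other {σ} {b} {v} {c} c≢b = go em
        where
        go : (d : Dec (c ≡ b)) → update′ σ v d ≡ σ c
        go (yes e) = contradiction e c≢b
        go (no _)  = refl

      update-elim : ∀ {p} (P : State → Set p) {σ b v c} → (c ≡ b → P v) → (c ≢ b → P (σ c)) →
                    P (update σ b v c)
      update-elim P {σ} {b} {v} {c} f g = go em
        where
        go : (d : Dec (c ≡ b)) → P (update′ σ v d)
        go (yes e) = f e
        go (no ¬e) = g ¬e

    -- The state of `b` decides whether the token `from b` exists, so `b` can serve as the spare
    -- element of the matching at `x`.
    adjust : ∀ {t x s σ b} m → Child b x → σ b ≡ nothing →
      ∃ λ v → (v ≡ nothing ⊎ v ≡ just m) × ∃ (Perfect (Active t x s (update σ b v)))
    adjust {t} {x} {s} {σ} {b} m ch σb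
      with match-up-to-one (Active t x s σ) (from b) (λ { (from _ e) → contradiction (trans (sym σb) e) λ () })
    ... | inj₁ (μ , perfect) = nothing , inj₁ refl , μ ,
      perfect-⇔ (active-cong refl λ _ → same) (active-cong refl λ _ → sym same) perfect
      where
      same : ∀ {c} → σ c ≡ update σ b nothing c
      same {c} = update-elim (σ c ≡_) (λ { refl → σb }) λ _ → refl
    ... | inj₂ (μ , perfect) = just m , inj₂ refl , μ , perfect-⇔ to to⁻¹ perfect
      where
      to : ∀ {τ} → Active t x s σ τ ⊎ τ ≡ from b → Active t x s (update σ b (just m)) τ
      to (inj₁ (own e)) = own e
      to (inj₁ (up e))  = up e
      to (inj₁ (from c e)) = from c (trans (update-other λ { refl → contradiction (trans (sym σb) e) λ () }) e)
      to (inj₂ refl)       = from ch update-same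

      to⁻¹ : ∀ {τ} → Active t x s (update σ b (just m)) τ → Active t x s σ τ ⊎ τ ≡ from b
      to⁻¹ (own e) = inj₁ (own e)
      to⁻¹ (up e)  = inj₁ (up e)
      to⁻¹ (from {c} d e) with decide (c ≡ b)
      ... | yes refl = inj₂ refl
      ... | no c≢b   = inj₁ (from d (trans (sym (update-other c≢b)) e))

    -- Along bad children, a demand to send a token up is passed on until it
    -- meets a token; from then on the chosen bad child absorbs the parity.
    no-bad : ∀ {x} → ¬ Bad x
    no-bad bad = bad (nothing , coinduct Q expand (bad , λ ()))
      where
      Q : V → State → Set ℓ
      Q x s = Bad x × (∀ {n} → s ≡ just n → Reach x n)

      Next : V → (V → State) → Set ℓ
      Next x σ = ∀ {c} → Child c x → Q c (σ c) ⊎ Good c (σ c)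

      next-chosen : ∀ {x} → Next x chosen
      next-chosen {x} {c} ch with decide (Bad c)
      ... | no ¬b = inj₂ (chosen-good ¬b)
      ... | yes b = inj₁ (b , λ e → contradiction (trans (sym (chosen-bad b)) e) λ ())

      next-update : ∀ {x σ b v} → Next x σ → Q b v ⊎ Good b v → Next x (update σ b v)
      next-update {σ = σ} next q {c} ch =
        update-elim (λ u → Q c u ⊎ Good c u) (λ { refl → q }) λ _ → next ch

      Expansion : V → State → Set ℓ
      Expansion x s = ∃ λ σ → Rule (T x) x s σ × Next x σ

      absorb : ∀ {x s} σ → Bad x → Next x σ → (∀ {c} → Bad c → σ c ≡ nothing) →
               (∀ {b v} → Bad b → ∃ (Perfect (Active (T x) x s (update σ b v))) →
                 Rule (T x) x s (update σ b v)) →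
               Expansion x s
      absorb {x} {s} σ bad next σ-bad finish
        with b , ch , b-bad ← bad-child bad
        -- The bound is fixed before parity decides the state of `b`: should `b` have to send a
        -- token up, `Reach` already backs the promise `just m`.
        with m , ρ ← reach b-bad
        with v , v≡ , matching ← adjust {T x} {x} {s} {σ} m ch (σ-bad b-bad)
        = update σ b v , finish b-bad matching , next-update next (inj₁ (b-bad , demand v≡))
        where
        demand : (v ≡ nothing ⊎ v ≡ just m) → ∀ {n} → v ≡ just n → Reach b n
        demand (inj₁ refl) ()
        demand (inj₂ refl) refl = ρ

      expand : ∀ {x s} → Q x s → Expansion x s
      expand {x} {nothing} (bad , _) =
        absorb chosen bad next-chosen chosen-bad λ _ (μ , perfect) → rule μ perfect λ ()
      expand {x} {just n} (bad , ρ) with ρ refl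
      -- Parity is settled first, whatever `up` gets matched with; `rematch` then redirects `up` to
      -- the vertex itself.
      ... | here Tx = absorb chosen bad next-chosen chosen-bad finish
        where
        finish : ∀ {b v} → Bad b → ∃ (Perfect (Active (T x) x (just n) (update chosen b v))) →
                 Rule (T x) x (just n) (update chosen b v)
        finish _ (μ , perfect) with μ′ , perfect′ , e ← rematch perfect (up refl) (own Tx) (λ ())
          = rule μ′ perfect′ λ _ → subst (Source _ _ _) (sym e) own
      -- `chosen c` may be another good state of `c`, so it is overridden by the one that sends a
      -- token.
      ... | via-good {c = c} {m} ch g m<n =
        absorb (update chosen c (just m)) bad (next-update next-chosen (inj₂ g))
          (λ {d} d-bad → trans (update-other λ { refl → d-bad (_ , g) }) (chosen-bad d-bad)) finish
        where
        finish : ∀ {b v} → Bad b →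
                 ∃ (Perfect (Active (T x) x (just n) (update (update chosen c (just m)) b v))) →
                 Rule (T x) x (just n) (update (update chosen c (just m)) b v)
        finish {b} {v} b-bad (μ , perfect) =
          let μ′ , perfect′ , e = rematch perfect (up refl) (from ch σc) (λ ()) in
          rule μ′ perfect′ λ { refl → subst (Source _ _ _) (sym e) (from ch σc m<n) }
          where
          σc : update (update chosen c (just m)) b v c ≡ just m
          σc = trans (update-other λ { refl → b-bad (_ , g) }) update-same
      -- Only `up` and `from c` are present, so they form the whole matching and nothing is left to
      -- absorb; the demand moves on to `c` with a smaller bound.
      ... | via-bad {c = c} {m} Tx quiet ch c-bad ρc m<n =
        σ , rule μ perfect (λ { refl → from ch update-same m<n }) ,
        next-update next-chosen (inj₁ (c-bad , λ { refl → ρc }))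
        where
        σ : V → State
        σ = update chosen c (just m)

        μ : Token → Token
        μ own      = own
        μ up       = from c
        μ (from _) = up

        perfect : Perfect (Active (T x) x (just n) σ) μ
        perfect (own e) = contradiction (trans (sym Tx) e) λ ()
        perfect (up _)  = from ch update-same , refl , λ ()
        perfect (from {d} d-ch e) with decide (d ≡ c)
        ... | yes refl = up refl , refl , λ ()
        ... | no d≢c = contradiction
          (trans (sym (trans (update-other d≢c) (chosen-nothing quiet d-ch))) e) λ ()

    all-good : ∀ x → ∃ (Good x)
    all-good x with decide (∃ (Good x))
    ... | yes g  = g
    ... | no bad = contradiction bad no-bad

    record Routing (T′ : Subset V) : Set ℓ where
      field
        state     : V → State
        state-N   : ∀ {x n} → state x ≡ just n → N x
        obeys     : ∀ x → Rule (T′ x) x (state x) state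

    -- At the root the parity is corrected by changing T there.
    route : ∃ λ T′ → (∀ x → x ≢ r → T′ x ≡ T x) × Routing T′
    route with _ , gᵣ ← all-good r with σᵣ , _ , goodᵣ ← unfold gᵣ
      = T′ , T′≡T , record { state = f ; state-N = f-N ; obeys = obeys }
      where
      root-rule : ∃ λ t → Rule t r nothing σᵣ
      -- The root has no edge upwards, so its own token is the spare element: whether it is needed
      -- defines the value of `T′` at `r`.
      root-rule with match-up-to-one (Active false r nothing σᵣ) own (λ { (own ()) })
      ... | inj₁ (μ , perfect) = false , rule μ perfect λ ()
      ... | inj₂ (μ , perfect) = true , rule μ (perfect-⇔ to to⁻¹ perfect) λ ()
        where
        to : ∀ {τ} → Active false r nothing σᵣ τ ⊎ τ ≡ own → Active true r nothing σᵣ τ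
        to (inj₁ (own ()))
        to (inj₁ (up ()))
        to (inj₁ (from c e)) = from c e
        to (inj₂ refl)       = own refl

        to⁻¹ : ∀ {τ} → Active true r nothing σᵣ τ → Active false r nothing σᵣ τ ⊎ τ ≡ own
        to⁻¹ (own _)    = inj₂ refl
        to⁻¹ (up ())
        to⁻¹ (from c e) = inj₁ (from c e)

      T″ : ∀ {x} → Dec (x ≡ r) → Bool
      T″ {x} (yes _) = proj₁ root-rule
      T″ {x} (no _)  = T x

      T′ : Subset V
      T′ x = T″ {x} em

      T′≡T : ∀ x → x ≢ r → T′ x ≡ T x
      T′≡T x x≢r = go em
        where
        go : (d : Dec (x ≡ r)) → T″ d ≡ T x
        go (yes e) = contradiction e x≢r
        go (no _)  = refl

      T′r : T′ r ≡ proj₁ root-rule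
      T′r = go em
        where
        go : (d : Dec (r ≡ r)) → T″ d ≡ proj₁ root-rule
        go (yes _) = refl
        go (no ¬e) = contradiction refl ¬e

      assign′ : ∀ {x s} → Dec (x ≡ r) → Dec (Good x s) → V → State
      assign′ (yes _) _       = σᵣ
      assign′ (no _)  (yes g) = proj₁ (unfold g)
      assign′ (no _)  (no _)  = λ _ → nothing

      assign : V → State → V → State
      assign x s = assign′ {x} {s} em em

      assign-r : ∀ {s} → assign r s ≡ σᵣ
      assign-r = go em em
        where
        go : ∀ {s} (d : Dec (r ≡ r)) (e : Dec (Good r s)) → assign′ d e ≡ σᵣ
        go (yes _) _ = refl
        go (no ¬e) _ = contradiction refl ¬e

      assign-good : ∀ {x s} → x ≢ r → Good x s →
                    Rule (T x) x s (assign x s) × (∀ {c} → Child c x → Good c (assign x s c))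
      assign-good {x} {s} x≢r g = go em em
        where
        go : (d : Dec (x ≡ r)) (e : Dec (Good x s)) →
             Rule (T x) x s (assign′ d e) × (∀ {c} → Child c x → Good c (assign′ d e c))
        go (yes e) _       = contradiction e x≢r
        go (no _)  (yes g) = proj₂ (unfold g)
        go (no _)  (no ¬g) = contradiction g ¬g

      -- States are handed down from parent to child. The number is fuel for the recursion towards
      -- the root; by `stable`, any amount above the depth gives the same value.
      state : ℕ → V → State
      state′ : ℕ → (x : V) → Dec (N x) → State
      state zero    x = nothing
      state (suc n) x = state′ n x em
      state′ n x (yes _) = assign (parent x) (state n (parent x)) x
      state′ n x (no _)  = nothing

      stable : ∀ {m n x} → depth x < m → depth x < n → state m x ≡ state n x
      stable {suc m} {suc n} {x} (s≤s d≤m) (s≤s d≤n) = go em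
        where
        go : (d : Dec (N x)) → state′ m x d ≡ state′ n x d
        go (yes Nx) = cong (λ s → assign (parent x) s x)
          (stable (<-≤-trans (depth-parent Nx) d≤m) (<-≤-trans (depth-parent Nx) d≤n))
        go (no _)   = refl

      f : V → State
      f x = state (suc (depth x)) x

      f-child : ∀ {x} → N x → f x ≡ assign (parent x) (f (parent x)) x
      f-child {x} Nx = go em
        where
        go : (d : Dec (N x)) → state′ (depth x) x d ≡ assign (parent x) (f (parent x)) x
        go (yes _) = cong (λ s → assign (parent x) s x) (stable (depth-parent Nx) ≤-refl)
        go (no ¬N) = contradiction Nx ¬N

      f-N : ∀ {x n} → f x ≡ just n → N x
      f-N {x} = go em
        where
        go : (d : Dec (N x)) → ∀ {n} → state′ (depth x) x d ≡ just n → N x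
        go (yes Nx) _ = Nx
        go (no _)   ()

      f-r : ∀ {x} → ¬ N x → f x ≡ nothing
      f-r {x} ¬N with f x in e
      ... | nothing = refl
      ... | just _  = contradiction (f-N e) ¬N

      f-good : ∀ x → Acc _<_ (depth x) → N x → Good x (f x)
      f-good x (acc rec) Nx = subst (Good x) (sym (f-child Nx)) (go (decide (parent x ≡ r)) (N-parent Nx))
        where
        go : Dec (parent x ≡ r) → parent x ≡ r ⊎ N (parent x) →
             Good x (assign (parent x) (f (parent x)) x)
        go (yes e) _         = subst (λ σ → Good x (σ x))
          (sym (trans (cong (λ y → assign y (f (parent x))) e) assign-r)) (goodᵣ (Nx , e))
        go (no p≢r) (inj₁ e) = contradiction e p≢r
        go (no p≢r) (inj₂ Np) =
          proj₂ (assign-good p≢r (f-good (parent x) (rec (depth-parent Nx)) Np)) (Nx , refl)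

      obeys : ∀ x → Rule (T′ x) x (f x) f
      obeys x = go (decide (x ≡ r)) (decide (N x))
        where
        go : Dec (x ≡ r) → Dec (N x) → Rule (T′ x) x (f x) f
        go (yes refl) _ = subst (λ s → Rule (T′ x) x s f) (sym (f-r r∉N))
          (rule-cong (sym T′r)
            (λ { {c} (Nc , refl) → sym (trans (f-child Nc) (cong (λ σ → σ c) assign-r)) })
            (proj₂ root-rule))
        go (no x≢r) (yes Nx) = rule-cong (sym (T′≡T x x≢r))
          (λ { (Nc , refl) → sym (f-child Nc) })
          (proj₁ (assign-good x≢r (f-good x (<-wellFounded _) Nx)))
        -- Outside the tree there are no tokens at all: `T-in` keeps `T` away, and by `N-parent` no
        -- vertex of the tree has its parent there.
        go (no x≢r) (no ¬Nx) = subst (λ s → Rule (T′ x) x s f) (sym (f-r ¬Nx))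
          (no-token (trans (T′≡T x x≢r) Tx) childless)
          where
          Tx : T x ≡ false
          Tx with T x in e
          ... | false = refl
          ... | true with T-in e
          ...   | inj₁ x≡r = contradiction x≡r x≢r
          ...   | inj₂ Nx  = contradiction Nx ¬Nx

          childless : ∀ {c n} → Child c x → f c ≢ just n
          childless (Nc , refl) _ with N-parent Nc
          ... | inj₁ e  = x≢r e
          ... | inj₂ Nx = ¬Nx Nx

    -- Following tokens through a routing

    module Trace {T′ : Subset V} (routing : Routing T′) where
      open Routing routing

      match : V → Token → Token
      match x = Rule.match (obeys x)

      Live : V → Token → Set ℓ
      Live x = Active (T′ x) x (state x) state

      match-live : ∀ {x τ} → Live x τ → Live x (match x τ)
      match-live {x} a = proj₁ (Rule.perfect (obeys x) a)

      match-involutive : ∀ {x τ} → Live x τ → match x (match x τ) ≡ τ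
      match-involutive {x} a = proj₁ (proj₂ (Rule.perfect (obeys x) a))

      match-≢ : ∀ {x τ} → Live x τ → match x τ ≢ τ
      match-≢ {x} a = proj₂ (proj₂ (Rule.perfect (obeys x) a))

      -- The token starting at t arrives after n steps at x, where it is called τ.
      data Arrives (t : V) : ℕ → V → Token → Set ℓ where
        start : T′ t ≡ true → Arrives t 0 t own
        climb : ∀ {n x τ} → Arrives t n x τ → match x τ ≡ up → Arrives t (suc n) (parent x) (from x)

      Visits : V → V → Token → Set ℓ
      Visits t x τ = ∃ λ n → Arrives t n x τ

      up-live⇒N : ∀ {x} → Live x up → N x
      up-live⇒N (up e) = state-N e

      arrives-T : ∀ {t n x τ} → Arrives t n x τ → T′ t ≡ true
      arrives-T (start e)   = e
      arrives-T (climb a _) = arrives-T a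

      arrives-live : ∀ {t n x τ} → Arrives t n x τ → Live x τ
      arrives-live (start e) = own e
      arrives-live (climb a e) with subst (Live _) e (match-live (arrives-live a))
      ... | up s = from (state-N s , refl) s

      climb-N : ∀ {t n x τ} → Arrives t n x τ → match x τ ≡ up → N x
      climb-N a e = up-live⇒N (subst (Live _) e (match-live (arrives-live a)))

      arrives-≢up : ∀ {t n x τ} → Arrives t n x τ → τ ≢ up
      arrives-≢up (start _) ()
      arrives-≢up (climb _ _) ()

      arrives-unique : ∀ {t n x y τ υ} → Arrives t n x τ → Arrives t n y υ → x ≡ y × τ ≡ υ
      arrives-unique (start _) (start _) = refl , refl
      arrives-unique (climb a _) (climb b _) with refl , refl ← arrives-unique a b = refl , refl

      climbed : ∀ {t n m y υ} → n < m → Arrives t m y υ →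
                ∃ λ x → ∃ λ τ → Arrives t n x τ × match x τ ≡ up
      climbed {n = n} {suc m} (s≤s n≤m) (climb b e) with m≤n⇒m<n∨m≡n n≤m
      ... | inj₁ n<m  = climbed n<m b
      ... | inj₂ refl = _ , _ , b , e

      -- Arrivals can be run backwards: `from x` names the vertex just left, and injectivity of the
      -- matching there recovers the previous token.
      same-start : ∀ {t t′ n m x τ} → Arrives t n x τ → Arrives t′ m x τ → t ≡ t′
      same-start (start _) (start _) = refl
      same-start (climb {x = x} a e) (climb b f)
        with refl ← perfect-injective (Rule.perfect (obeys x))
                      (arrives-live a) (arrives-live b) (trans e (sym f))
        = same-start a b

      -- Of two different stops of one token, the later could only be reached by climbing on from
      -- the earlier.
      same-end : ∀ {t n m x y τ υ} → Arrives t n x τ → match x τ ≢ up →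
                 Arrives t m y υ → match y υ ≢ up → x ≡ y × τ ≡ υ
      same-end {n = n} {m} a a-stops b b-stops with <-cmp n m
      ... | tri≈ _ refl _ = arrives-unique a b
      ... | tri< n<m _ _ with _ , _ , a′ , e ← climbed n<m b
                         with refl , refl ← arrives-unique a a′ = contradiction e a-stops
      ... | tri> _ _ m<n with _ , _ , b′ , e ← climbed m<n a
                         with refl , refl ← arrives-unique b b′ = contradiction e b-stops

      -- The descent is paid for by the promise in the state, which drops at each edge by `Source`.
      start-of : ∀ {x τ} → Live x τ → τ ≢ up → ∃ λ t → Visits t x τ
      start-of (own e)  _ = _ , _ , start e
      start-of (up _)   f = contradiction refl f
      start-of (from (Nc , refl) e) _ = go (<-wellFounded _) Nc e
        where
        go : ∀ {c n} → Acc _<_ n → N c → state c ≡ just n → ∃ λ t → Visits t (parent c) (from c)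
        go {c} (acc rec) Nc e
          with match c up | Rule.source (obeys c) e | match-live {c} (up e) | match-involutive {c} (up e)
        ... | _ | own | own T′c | back = c , _ , climb (start T′c) back
        ... | _ | from (Nd , refl) e′ m<n | _ | back with t , _ , a ← go (rec m<n) Nd e′ =
          t , _ , climb a back

      -- Each climb lowers the depth.
      stop-of : ∀ {t n x τ} → Arrives t n x τ → ∃ λ y → ∃ λ υ → Visits t y υ × match y υ ≢ up
      stop-of a = go (<-wellFounded _) a
        where
        go : ∀ {t n x τ} → Acc _<_ (depth x) → Arrives t n x τ →
             ∃ λ y → ∃ λ υ → Visits t y υ × match y υ ≢ up
        go {x = x} {τ} (acc rec) a with decide (match x τ ≡ up)
        ... | yes e = go (rec (depth-parent (climb-N a e))) (climb a e)
        ... | no f  = x , τ , (_ , a) , f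

      -- The place of meeting is the top of the future path: there the two tokens are matched with
      -- each other instead of with `up`.
      Meet : V → V → Set ℓ
      Meet t t′ = ∃ λ x → ∃ λ τ → Visits t x τ × Visits t′ x (match x τ) × match x τ ≢ up

      meet-sym : ∀ {t t′} → Meet t t′ → Meet t′ t
      meet-sym {t} (x , τ , (n , a) , b , f) = x , match x τ , b ,
        (n , subst (Arrives t n x) (sym back) a) , λ e → arrives-≢up a (trans (sym back) e)
        where back = match-involutive (arrives-live a)

      stops : ∀ {t n x τ} → Arrives t n x (match x τ) → Live x τ → τ ≢ up → match x (match x τ) ≢ up
      stops b live τ≢up e = τ≢up (trans (sym (match-involutive live)) e)

      meet-irrefl : ∀ {t} → ¬ Meet t t
      meet-irrefl (x , τ , (_ , a) , (_ , b) , f)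
        with _ , e ← same-end a f b (stops b (arrives-live a) (arrives-≢up a))
        = match-≢ (arrives-live a) (sym e)

      meet-functional : ∀ {t u v} → Meet t u → Meet t v → u ≡ v
      meet-functional (_ , _ , (_ , a) , (_ , b) , f) (_ , _ , (_ , a′) , (_ , b′) , f′)
        with refl , refl ← same-end a f a′ f′ = same-start b b′

      meet-T : ∀ {t u} → Meet t u → T′ t ≡ true
      meet-T (_ , _ , (_ , a) , _) = arrives-T a

      meet-total : ∀ {t} → T′ t ≡ true → ∃ λ u → Meet t u
      meet-total T′t with x , τ , (n , a) , f ← stop-of (start T′t)
        with u , b ← start-of (match-live (arrives-live a)) f = u , x , τ , (n , a) , b , f

  -- Walks and linkings

  Least : ∀ {p} → (ℕ → Set p) → Set p
  Least P = ∃ λ m → P m × (∀ {k} → P k → m ≤ k)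

  least : ∀ {p} {P : ℕ → Set p} n → P n → Least P
  least zero Pn = zero , Pn , λ _ → z≤n
  least {P = P} (suc n) Pn with decide (P zero)
  ... | yes P0 = zero , P0 , λ _ → z≤n
  ... | no ¬P0 with m , Pm , min ← least {P = λ k → P (suc k)} n Pn
    = suc m , Pm , λ { {zero} P0 → contradiction P0 ¬P0 ; {suc k} Pk → s≤s (min Pk) }

  module Walks {ℓ} (G : Graph ℓ) where
    open Graph G hiding (V)

    data WalkIn (K : E → Set ℓ) : V G → V G → Set ℓ where
      nil  : ∀ {x} → WalkIn K x x
      cons : ∀ {e x y z} → K e → Joins e x y → WalkIn K y z → WalkIn K x z

    forget : ∀ {K x y} → WalkIn K x y → Walk x y
    forget nil          = nil
    forget (cons _ j w) = cons _ j (forget w)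

    forget-in : ∀ {K x y} (w : WalkIn K x y) {e} → e ∈ˡ edges (forget w) → K e
    forget-in (cons Ke _ _) (here refl) = Ke
    forget-in (cons _ _ w)  (there m)   = forget-in w m

    restrict : ∀ {K : E → Set ℓ} {x y} (w : Walk x y) → (∀ {e} → e ∈ˡ edges w → K e) → WalkIn K x y
    restrict nil          i = nil
    restrict (cons e j w) i = cons (i (here refl)) j (restrict w λ m → i (there m))

    trans-walk : ∀ {K x y z} → WalkIn K x y → WalkIn K y z → WalkIn K x z
    trans-walk nil           v = v
    trans-walk (cons Ke j w) v = cons Ke j (trans-walk w v)

    snoc : ∀ {K e x y z} → WalkIn K x y → K e → Joins e y z → WalkIn K x z
    snoc w Ke j = trans-walk w (cons Ke j nil)

    sym-walk : ∀ {K x y} → WalkIn K x y → WalkIn K y x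
    sym-walk nil           = nil
    sym-walk (cons Ke j w) = snoc (sym-walk w) Ke (⊎-swap j)

    weaken : ∀ {K K′ x y} → (∀ {e} → K e → K′ e) → WalkIn K x y → WalkIn K′ x y
    weaken f nil           = nil
    weaken f (cons Ke j w) = cons (f Ke) j (weaken f w)

    to-end₁ : ∀ {K : E → Set ℓ} {x y e} (w : Walk x y) → (∀ {e} → e ∈ˡ edges w → K e) →
              e ∈ˡ edges w → WalkIn K x (end₁ e)
    to-end₁ (cons e (inj₁ (refl , _)) w) i (here refl) = nil
    to-end₁ (cons e (inj₂ (refl , q)) w) i (here refl) = cons (i (here refl)) (inj₂ (refl , q)) nil
    to-end₁ (cons e j w) i (there m) = cons (i (here refl)) j (to-end₁ w (λ n → i (there n)) m)

    suffix : ∀ {K : E → Set ℓ} {x y z} (w : Walk x y) → Unique (vertices w) → (∀ {e} → e ∈ˡ edges w → K e) →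
             z ∈ˡ vertices w → Σ (Path z y) λ p → ∀ {e} → e ∈ˡ pathEdges p → K e
    suffix nil          u i (here refl) = record { walk = nil ; simple = u } , i
    suffix (cons e j w) u i (here refl) = record { walk = cons e j w ; simple = u } , i
    suffix (cons e j w) (_ ∷ u) i (there m) = suffix w u (λ n → i (there n)) m

    simplify : ∀ {K x y} → WalkIn K x y → Σ (Path x y) λ p → ∀ {e} → e ∈ˡ pathEdges p → K e
    simplify nil = record { walk = nil ; simple = [] ∷ [] } , λ ()
    simplify {x = x} (cons {e} Ke j w) with simplify w
    ... | p , p-in with decide (x ∈ˡ vertices (Path.walk p))
    ...   | yes m = suffix (Path.walk p) (Path.simple p) p-in m
    ...   | no ∉p = record { walk   = cons e j (Path.walk p)
                           ; simple = ¬Any⇒All¬ _ ∉p ∷ Path.simple p } ,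
                    λ { (here refl) → Ke ; (there m) → p-in m }

    -- A join in symmetric form: every pair is linked in both orders, so no source has to be
    -- selected, and walks replace paths. By functionality, the conclusion of `disjoint` says that
    -- the two links belong to the same pair. The set `K` confines the edges, so that linkings in
    -- edge-disjoint parts can be united.
    record Linking (K : E → Set ℓ) (T : Subset (V G)) : Set (Level.suc ℓ) where
      field
        Link       : V G → V G → Set ℓ
        link-sym   : ∀ {x y} → Link x y → Link y x
        irreflexive : ∀ {x} → ¬ Link x x
        functional : ∀ {x y z} → Link x y → Link x z → y ≡ z
        link-T     : ∀ {x y} → Link x y → T x ≡ true
        total      : ∀ {x} → T x ≡ true → ∃ λ y → Link x y
        walk       : ∀ {x y} → Link x y → Walk x y
        inside     : ∀ {x y} (l : Link x y) {e} → e ∈ˡ edges (walk l) → K e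
        disjoint   : ∀ {x y x′ y′} (l : Link x y) (l′ : Link x′ y′) {e} →
                     e ∈ˡ edges (walk l) → e ∈ˡ edges (walk l′) → x ≡ x′ ⊎ y ≡ x′

      perfect : ∃ (Perfect λ x → T x ≡ true)
      perfect =
        let μ , perfect , _ = relation⇒perfect Link link-sym irreflexive functional link-T total in
        μ , perfect

    -- The breadth-first tree of the part reached from `r` by edges in `K`

    module Connected-part (K : E → Set ℓ) (r : V G) where

      data Distance : ℕ → V G → Set ℓ where
        zero : Distance zero r
        suc  : ∀ {n x y e} → K e → Joins e x y → Distance n y → Distance (suc n) x

      distance : ∀ {x} → WalkIn K x r → ∃ λ n → Distance n x
      distance nil           = zero , zero
      distance (cons Ke j w) with n , d ← distance w = suc n , suc Ke j d

      Nearest : V G → Set ℓ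
      Nearest x = Least λ n → Distance n x

      depth′ : ∀ {x} → Dec (Nearest x) → ℕ
      depth′ (yes (n , _)) = n
      depth′ (no _)        = zero

      above′ : ∀ {x} → Dec (Nearest x) → Maybe (E × V G)
      above′ (yes (_ , zero , _))                      = nothing
      above′ (yes (_ , suc {y = y} {e} _ _ _ , _)) = just (e , y)
      above′ (no _)                                    = nothing

      -- Depth and parent edge are read off one and the same shortest walk to `r`, so the far end of
      -- that edge has a smaller depth. Unreachable vertices get depth zero and no parent edge.
      depth : V G → ℕ
      depth x = depth′ {x} em

      above : V G → Maybe (E × V G)
      above x = above′ {x} em

      depth-≤ : ∀ {n x} → Distance n x → depth x ≤ n
      depth-≤ {n} {x} d = go em
        where
        go : (a : Dec (Nearest x)) → depth′ a ≤ n
        go (yes (_ , _ , min)) = min d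
        go (no far)            = contradiction (least _ d) far

      above-spec : ∀ {x e y} → above x ≡ just (e , y) →
                   K e × Joins e x y × ∃ λ n → Distance n y × n < depth x
      above-spec {x} {e} {y} = go em
        where
        go : (a : Dec (Nearest x)) → above′ a ≡ just (e , y) →
             K e × Joins e x y × ∃ λ n → Distance n y × n < depth′ a
        go (yes (_ , suc k j d , _)) refl = k , j , _ , d , ≤-refl

      N : V G → Set ℓ
      N x = ∃ λ p → above x ≡ just p

      root-or-N : ∀ {n x} → Distance n x → x ≡ r ⊎ N x
      root-or-N {x = x} d = go em
        where
        go : (a : Dec (Nearest x)) → x ≡ r ⊎ ∃ λ p → above′ a ≡ just p
        go (yes (_ , zero , _))      = inj₁ refl
        go (yes (_ , suc _ _ _ , _)) = inj₂ (_ , refl)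
        go (no far)                  = contradiction (least _ d) far

      root∉N : ¬ N r
      root∉N = go em
        where
        go : (a : Dec (Nearest r)) → ¬ ∃ λ p → above′ a ≡ just p
        go (yes (_ , zero , _)) (_ , ())
        go (yes (_ , suc _ _ _ , min)) _ with () ← min zero
        go (no _) (_ , ())

      parent : V G → V G
      parent x = maybe′ proj₂ x (above x)

      parent≡ : ∀ {x e y} → above x ≡ just (e , y) → parent x ≡ y
      parent≡ {x} = cong (maybe′ proj₂ x)

      depth-parent : ∀ {x} → N x → depth (parent x) < depth x
      depth-parent ((e , y) , a) rewrite parent≡ a with _ , _ , _ , d , n< ← above-spec a
        = ≤-<-trans (depth-≤ d) n<

      N-parent : ∀ {x} → N x → parent x ≡ r ⊎ N (parent x)
      N-parent ((e , y) , a) rewrite parent≡ a with _ , _ , _ , d , _ ← above-spec a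
        = root-or-N d

      Above : V G → E → Set ℓ
      Above x e = ∃ λ y → above x ≡ just (e , y)

      -- An edge lying above both of its ends would make each end nearer to `r` than the other.
      above-injective : ∀ {x x′ e} → Above x e → Above x′ e → x ≡ x′
      above-injective (y , a) (y′ , a′)
        with _ , j , _ , d , n< ← above-spec a | _ , j′ , _ , d′ , n<′ ← above-spec a′
        with j | j′
      ... | inj₁ (refl , refl) | inj₁ (refl , refl) = refl
      ... | inj₂ (refl , refl) | inj₂ (refl , refl) = refl
      ... | inj₁ (refl , refl) | inj₂ (refl , refl) =
        contradiction (≤-<-trans (depth-≤ d) n<) (<-asym (≤-<-trans (depth-≤ d′) n<′))
      ... | inj₂ (refl , refl) | inj₁ (refl , refl) =
        contradiction (≤-<-trans (depth-≤ d) n<) (<-asym (≤-<-trans (depth-≤ d′) n<′))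

      module _ (T : Subset (V G)) (T-in : ∀ {x} → T x ≡ true → WalkIn K x r) where

        open Forest r N parent depth depth-parent N-parent root∉N T
          (λ Tx → root-or-N (proj₂ (distance (T-in Tx))))

        module _ {T′} (routing : Routing T′) where
          open Trace routing

          Uses : V G → E → Set ℓ
          Uses t e = ∃ λ x → Above x e × Visits t (parent x) (from x)

          track : ∀ {t n x τ} → Arrives t n x τ → WalkIn (Uses t) t x
          track (start _) = nil
          track (climb {x = x} a m) with (e , y) , a≡ ← climb-N a m
            = snoc (track a) (x , (y , a≡) , _ , climb a m)
                (subst (Joins e x) (sym (parent≡ a≡)) (proj₁ (proj₂ (above-spec a≡))))

          Uses₂ : V G → V G → E → Set ℓ
          Uses₂ t t′ e = Uses t e ⊎ Uses t′ e

          uses-K : ∀ {t e} → Uses t e → K e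
          uses-K (_ , (_ , a≡) , _) = proj₁ (above-spec a≡)

          -- The edge determines the vertex `x` below it, and the token `from x` determines where it
          -- started.
          uses-unique : ∀ {t t′ e} → Uses t e → Uses t′ e → t ≡ t′
          uses-unique (x , a , _ , v) (x′ , a′ , _ , v′) with refl ← above-injective a a′
            = same-start v v′

          meeting-walk : ∀ {t t′} → Meet t t′ → WalkIn (Uses₂ t t′) t t′
          meeting-walk (_ , _ , (_ , a) , (_ , b) , _) =
            trans-walk (weaken inj₁ (track a)) (sym-walk (weaken inj₂ (track b)))

          linking : Linking K T′
          linking = record
            { Link = Meet ; link-sym = meet-sym ; irreflexive = meet-irrefl
            ; functional = meet-functional ; link-T = meet-T ; total = meet-total
            ; walk = λ l → forget (meeting-walk l)
            ; inside = λ l m → [ uses-K , uses-K ]′ (forget-in (meeting-walk l) m)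
            ; disjoint = λ l l′ m m′ →
                clash l l′ (forget-in (meeting-walk l) m) (forget-in (meeting-walk l′) m′)
            }
            where
            clash : ∀ {x y x′ y′ e} → Meet x y → Meet x′ y′ → Uses₂ x y e → Uses₂ x′ y′ e → x ≡ x′ ⊎ y ≡ x′
            clash l l′ (inj₁ a) (inj₁ b) = inj₁ (uses-unique a b)
            clash l l′ (inj₂ a) (inj₁ b) = inj₂ (uses-unique a b)
            clash l l′ (inj₁ a) (inj₂ b) with refl ← uses-unique a b = inj₂ (meet-functional l (meet-sym l′))
            clash l l′ (inj₂ a) (inj₂ b) with refl ← uses-unique a b =
              inj₁ (meet-functional (meet-sym l) (meet-sym l′))

        -- Routing changes `T` at most at `r`, and a Boolean different from `T r` is its negation.
        linking-or-toggled : Linking K T ⊎ Linking K (T ⊕ r)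
        linking-or-toggled with T′ , T′≡T , routing ← route with decide (T′ r ≡ T r)
        ... | yes e = inj₁ (subst (Linking K) (ext pointwise) (linking routing))
          where
          pointwise : ∀ x → T′ x ≡ T x
          pointwise x with decide (x ≡ r)
          ... | yes refl = e
          ... | no x≢r   = T′≡T x x≢r
        ... | no ne = inj₂ (subst (Linking K) (ext λ x → pointwise x em) (linking routing))
          where
          flip : ∀ {b c} → b ≢ c → b ≡ c xor true
          flip {true}  {true}  f = contradiction refl f
          flip {true}  {false} f = refl
          flip {false} {true}  f = refl
          flip {false} {false} f = contradiction refl f

          pointwise : ∀ x → (d : Dec (x ≡ r)) → T′ x ≡ T x xor does d
          pointwise x (yes refl) = flip ne
          pointwise x (no x≢r)   = trans (T′≡T x x≢r) (sym (xor-identityʳ _))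

  -- Exchanging a linking along a walk

  module Linked {ℓ} (G : Graph ℓ) where
    open Graph G hiding (V)
    open Walks G

    AnyEdge : E → Set ℓ
    AnyEdge _ = Lift ℓ ⊤

    union : ∀ {K₁ K₂ S₁ S₂} {R : Subset (V G)} → Linking K₁ S₁ → Linking K₂ S₂ →
      (∀ {x} → S₁ x ≡ true → S₂ x ≢ true) → (∀ {e} → K₁ e → ¬ K₂ e) →
      (∀ {x} → S₁ x ≡ true → R x ≡ true) → (∀ {x} → S₂ x ≡ true → R x ≡ true) →
      (∀ {x} → R x ≡ true → S₁ x ≡ true ⊎ S₂ x ≡ true) → Linking AnyEdge R
    union {R = R} L₁ L₂ S-disjoint K-disjoint S₁⊆R S₂⊆R R⊆ = record
      { Link = Link ; link-sym = link-sym ; irreflexive = [ L₁.irreflexive , L₂.irreflexive ]′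
      ; functional = functional ; link-T = [ (λ l → S₁⊆R (L₁.link-T l)) , (λ l → S₂⊆R (L₂.link-T l)) ]′
      ; total = λ Rx → total (R⊆ Rx) ; walk = walk ; inside = λ _ _ → lift tt ; disjoint = disjoint }
      where
      module L₁ = Linking L₁
      module L₂ = Linking L₂

      Link : V G → V G → Set ℓ
      Link x y = L₁.Link x y ⊎ L₂.Link x y

      link-sym : ∀ {x y} → Link x y → Link y x
      link-sym (inj₁ l) = inj₁ (L₁.link-sym l)
      link-sym (inj₂ l) = inj₂ (L₂.link-sym l)

      functional : ∀ {x y z} → Link x y → Link x z → y ≡ z
      functional (inj₁ l) (inj₁ m) = L₁.functional l m
      functional (inj₁ l) (inj₂ m) = contradiction (L₂.link-T m) (S-disjoint (L₁.link-T l))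
      functional (inj₂ l) (inj₁ m) = contradiction (L₂.link-T l) (S-disjoint (L₁.link-T m))
      functional (inj₂ l) (inj₂ m) = L₂.functional l m

      total : ∀ {x} → _ → ∃ λ y → Link x y
      total (inj₁ S) = let y , l = L₁.total S in y , inj₁ l
      total (inj₂ S) = let y , l = L₂.total S in y , inj₂ l

      walk : ∀ {x y} → Link x y → Walk x y
      walk (inj₁ l) = L₁.walk l
      walk (inj₂ l) = L₂.walk l

      disjoint : ∀ {x y x′ y′} (l : Link x y) (l′ : Link x′ y′) {e} →
                 e ∈ˡ edges (walk l) → e ∈ˡ edges (walk l′) → x ≡ x′ ⊎ y ≡ x′
      disjoint (inj₁ l) (inj₁ l′) m m′ = L₁.disjoint l l′ m m′
      disjoint (inj₁ l) (inj₂ l′) m m′ = contradiction (L₂.inside l′ m′) (K-disjoint (L₁.inside l m))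
      disjoint (inj₂ l) (inj₁ l′) m m′ = contradiction (L₂.inside l m) (K-disjoint (L₁.inside l′ m′))
      disjoint (inj₂ l) (inj₂ l′) m m′ = L₂.disjoint l l′ m m′

    -- Only finitely many links touch the walk w.  Together with w they form a
    -- connected part of G, in which the vertices concerned can be linked anew.
    module Exchange {u v} (w : Walk u v) {T : Subset (V G)} (L : Linking AnyEdge T) where
      open Linking L

      Hit : V G → Set ℓ
      Hit x = (∃ λ y → Σ (Link x y) λ l → ∃ λ e → e ∈ˡ edges (walk l) × e ∈ˡ edges w) ⊎ x ≡ u ⊎ x ≡ v

      -- Both ends are consulted because the walks of the two orders of a pair may differ and
      -- because only one end may be `u` or `v`. Counting `u` and `v` as hit keeps them out of the
      -- untouched rest.
      Touched : V G → Set ℓ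
      Touched x = ∃ λ y → Link x y × (Hit x ⊎ Hit y)

      T₀ T₁ : Subset (V G)
      T₀ x = ⌊ Touched x ⌋
      T₁ x = ⌊ T x ≡ true × ¬ Touched x ⌋

      touched-link : ∀ {x y} → Link x y → Touched x → Touched y
      touched-link l (z , l′ , h) with refl ← functional l l′ = _ , link-sym l , ⊎-swap h

      perfect₀ : ∃ (Perfect λ x → T₀ x ≡ true)
      perfect₀ = let μ , perfect , _ = relation⇒perfect R R-sym (λ (l , _) → irreflexive l)
                       (λ (l , _) (m , _) → functional l m) (λ (_ , t) → complete t)
                       (λ e → let y , l , h = sound e in y , l , y , l , h)
                 in μ , perfect
        where
        R : V G → V G → Set ℓ
        R x y = Link x y × Touched x
        R-sym : ∀ {x y} → R x y → R y x
        R-sym (l , t) = link-sym l , touched-link l t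

      Owned : E → Set ℓ
      Owned e = ∃ λ x → ∃ λ y → Σ (Link x y) λ l → e ∈ˡ edges (walk l)

      ends : ∀ {e} → Dec (Owned e) → List (V G)
      ends (yes (x , y , _)) = x ∷ y ∷ []
      ends (no _)            = []

      -- By disjointness an edge determines the pair whose link runs through it, so each edge of `w`
      -- contributes at most two vertices. This is where finiteness of `T₀` comes from.
      owners : List E → List (V G)
      owners []       = []
      owners (e ∷ es) = ends {e} em ++ owners es

      ∈-ends : ∀ {e x y} (l : Link x y) → e ∈ˡ edges (walk l) → (d : Dec (Owned e)) →
               x ∈ˡ ends d × y ∈ˡ ends d
      ∈-ends l m (no none) = contradiction (_ , _ , l , m) none
      ∈-ends l m (yes (x′ , y′ , l′ , m′)) with disjoint l l′ m m′
      ... | inj₁ refl with refl ← functional l l′ = here refl , there (here refl)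
      ... | inj₂ refl with refl ← functional (link-sym l) l′ = there (here refl) , here refl

      ∈-owners : ∀ {e x y} (l : Link x y) → e ∈ˡ edges (walk l) → ∀ {es} → e ∈ˡ es →
                 x ∈ˡ owners es × y ∈ˡ owners es
      ∈-owners l m (here refl) = let p , q = ∈-ends l m em in ∈-++⁺ˡ p , ∈-++⁺ˡ q
      ∈-owners l m {e ∷ _} (there n) =
        let p , q = ∈-owners l m n in ∈-++⁺ʳ (ends {e} em) p , ∈-++⁺ʳ (ends {e} em) q

      mates : ∀ {x} → Dec (∃ λ y → Link x y) → List (V G)
      mates {x} (yes (y , _)) = x ∷ y ∷ []
      mates (no _)            = []

      ∈-mates : ∀ {x y} → Link x y → (d : Dec (∃ λ y → Link x y)) → x ∈ˡ mates d × y ∈ˡ mates d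
      ∈-mates l (no none) = contradiction (_ , l) none
      ∈-mates l (yes (_ , l′)) with refl ← functional l l′ = here refl , there (here refl)

      touched-list : List (V G)
      touched-list = mates {u} em ++ mates {v} em ++ owners (edges w)

      hit-listed : ∀ {x y} → Link x y → Hit x → x ∈ˡ touched-list × y ∈ˡ touched-list
      hit-listed l (inj₁ (_ , l′ , _ , m , n)) with refl ← functional l l′ =
        let p , q = ∈-owners l′ m n in
        ∈-++⁺ʳ (mates {u} em) (∈-++⁺ʳ (mates {v} em) p) , ∈-++⁺ʳ (mates {u} em) (∈-++⁺ʳ (mates {v} em) q)
      hit-listed l (inj₂ (inj₁ refl)) = let p , q = ∈-mates l em in ∈-++⁺ˡ p , ∈-++⁺ˡ q
      hit-listed l (inj₂ (inj₂ refl)) = let p , q = ∈-mates l em in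
        ∈-++⁺ʳ (mates {u} em) (∈-++⁺ˡ p) , ∈-++⁺ʳ (mates {u} em) (∈-++⁺ˡ q)

      touched-listed : ∀ {x} → T₀ x ≡ true → x ∈ˡ touched-list
      touched-listed e with sound e
      ... | _ , l , inj₁ h = proj₁ (hit-listed l h)
      ... | _ , l , inj₂ h = proj₂ (hit-listed (link-sym l) h)

      K : E → Set ℓ
      K e = e ∈ˡ edges w ⊎ ∃ λ x → ∃ λ y → Σ (Link x y) λ l → Touched x × e ∈ˡ edges (walk l)

      w-in-K : WalkIn K u v
      w-in-K = restrict w inj₁

      link-in-K : ∀ {x y} (l : Link x y) → Touched x → ∀ {e} → e ∈ˡ edges (walk l) → K e
      link-in-K l t m = inj₂ (_ , _ , l , t , m)

      -- A common edge serves as the bridge: along the link to its `end₁`, then along `w` back to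
      -- `u`.
      hit-joined : ∀ {x y} → Link x y → Hit x → WalkIn K x u
      hit-joined l h@(inj₁ (_ , l′ , _ , m , n)) = trans-walk
        (to-end₁ (walk l′) (link-in-K l′ (_ , l′ , inj₁ h)) m)
        (sym-walk (to-end₁ w inj₁ n))
      hit-joined l (inj₂ (inj₁ refl)) = nil
      hit-joined l (inj₂ (inj₂ refl)) = sym-walk w-in-K

      touched-joined : ∀ {x} → Touched x → WalkIn K x u
      touched-joined (_ , l , inj₁ h) = hit-joined l h
      touched-joined (_ , l , inj₂ h) = trans-walk
        (restrict (walk l) (link-in-K l (_ , l , inj₂ h))) (hit-joined (link-sym l) h)

      joined : ∀ {x} → (T₀ ⊕ v) x ≡ true → WalkIn K x u
      joined {x} e = go (decide (x ≡ v))
        where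
        go : Dec (x ≡ v) → WalkIn K x u
        go (yes refl) = sym-walk w-in-K
        go (no x≢v)   = touched-joined (sound (trans (sym (⊕-other T₀ x≢v)) e))

      relinked : Linking K (T₀ ⊕ v ⊕ u)
      relinked with Connected-part.linking-or-toggled K u (T₀ ⊕ v) joined
      ... | inj₂ L′ = L′
      -- The old links match `T₀` perfectly, so it is even; then `T₀ ⊕ v` is odd and has no linking.
      ... | inj₁ L′ with ys , e ← finite⇒toggles T₀ touched-list touched-listed =
        contradiction (trans (sym (perfect⇒even (v ∷ ys) (proj₂ odd-perfect))) (cong not even)) λ ()
        where
        even : odd ys ≡ false
        even = perfect⇒even ys (proj₂ (subst (λ S → ∃ (Perfect λ x → S x ≡ true)) e perfect₀))

        odd-perfect : ∃ (Perfect λ x → (∅ ⊕⋆ (v ∷ ys)) x ≡ true)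
        odd-perfect = subst (λ S → ∃ (Perfect λ x → (S ⊕ v) x ≡ true)) e (Linking.perfect L′)

      K₁ : E → Set ℓ
      K₁ e = ∃ λ x → ∃ λ y → Σ (Link x y) λ l → ¬ Touched x × e ∈ˡ edges (walk l)

      untouched : Linking K₁ T₁
      untouched = record
        { Link = λ x y → Link x y × ¬ Touched x
        ; link-sym = λ (l , f) → link-sym l , λ t → f (touched-link (link-sym l) t)
        ; irreflexive = λ (l , _) → irreflexive l
        ; functional = λ (l , _) (m , _) → functional l m
        ; link-T = λ (l , f) → complete (link-T l , f)
        ; total = λ e → let Tx , f = sound e ; y , l = total Tx in y , l , f
        ; walk = λ (l , _) → walk l
        ; inside = λ (l , f) m → _ , _ , l , f , m
        ; disjoint = λ (l , _) (l′ , _) → disjoint l l′ }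

      K-disjoint : ∀ {e} → K₁ e → ¬ K e
      K-disjoint (_ , _ , l , f , m) (inj₁ n) = f (_ , l , inj₁ (inj₁ (_ , l , _ , m , n)))
      K-disjoint (_ , _ , l , f , m) (inj₂ (_ , _ , l′ , t , m′)) with disjoint l l′ m m′
      ... | inj₁ refl = f t
      ... | inj₂ refl = f (touched-link (link-sym l) t)

      -- Each vertex is of one of these kinds. An untouched vertex of `T` differs from `u` and `v`,
      -- so toggling does not affect it; everywhere else `T₀` agrees with `T`, and so do the toggled
      -- sets.
      Same New : V G → Set
      Same x = (T₀ ⊕ v ⊕ u) x ≡ (T ⊕ u ⊕ v) x × T₁ x ≡ false
      New x = (T₀ ⊕ v ⊕ u) x ≡ false × T₁ x ≡ true × (T ⊕ u ⊕ v) x ≡ true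

      same-or-new : ∀ x → Same x ⊎ New x
      same-or-new x = go (T x) refl (decide (Touched x))
        where
        same : T₀ x ≡ T x → (T₀ ⊕ v ⊕ u) x ≡ (T ⊕ u ⊕ v) x
        same e = trans (cong (λ b → (b xor ⌊ x ≡ v ⌋) xor ⌊ x ≡ u ⌋) e) (cong (λ S → S x) (⊕-comm T v u))

        go : ∀ b → T x ≡ b → Dec (Touched x) → Same x ⊎ New x
        go b Tx (yes t) = inj₁
          (same (trans (complete t) (sym (link-T (proj₁ (proj₂ t))))) , complete⁻ λ (_ , f) → f t)
        go false Tx (no f) = inj₁ (same (trans (complete⁻ f) (sym Tx)) ,
          complete⁻ λ (Tx′ , _) → contradiction (trans (sym Tx) Tx′) λ ())
        go true Tx (no f) = inj₂
          ( trans (trans (⊕-other (T₀ ⊕ v) x≢u) (⊕-other T₀ x≢v)) (complete⁻ f)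
          , complete (Tx , f)
          , trans (trans (⊕-other (T ⊕ u) x≢v) (⊕-other T x≢u)) Tx )
          where
          l = proj₂ (total Tx)
          x≢u : x ≢ u
          x≢u e = f (_ , l , inj₁ (inj₂ (inj₁ e)))
          x≢v : x ≢ v
          x≢v e = f (_ , l , inj₁ (inj₂ (inj₂ e)))

      exchange : Linking AnyEdge (T ⊕ u ⊕ v)
      exchange = union untouched relinked
        (λ {x} p q → case₁ (same-or-new x) p q) K-disjoint
        (λ {x} → case₂ (same-or-new x)) (λ {x} → case₃ (same-or-new x)) (λ {x} → case₄ (same-or-new x))
        where
        case₁ : ∀ {x} → Same x ⊎ New x → T₁ x ≡ true → (T₀ ⊕ v ⊕ u) x ≢ true
        case₁ (inj₁ (_ , f)) p _ = contradiction (trans (sym f) p) λ ()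
        case₁ (inj₂ (f , _)) _ q = contradiction (trans (sym f) q) λ ()
        case₂ : ∀ {x} → Same x ⊎ New x → T₁ x ≡ true → (T ⊕ u ⊕ v) x ≡ true
        case₂ (inj₁ (_ , f)) p = contradiction (trans (sym f) p) λ ()
        case₂ (inj₂ (_ , _ , r)) _ = r
        case₃ : ∀ {x} → Same x ⊎ New x → (T₀ ⊕ v ⊕ u) x ≡ true → (T ⊕ u ⊕ v) x ≡ true
        case₃ (inj₁ (e , _)) q = trans (sym e) q
        case₃ (inj₂ (_ , _ , r)) _ = r
        case₄ : ∀ {x} → Same x ⊎ New x → (T ⊕ u ⊕ v) x ≡ true → T₁ x ≡ true ⊎ (T₀ ⊕ v ⊕ u) x ≡ true
        case₄ (inj₁ (e , _)) r = inj₂ (trans e r)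
        case₄ (inj₂ (_ , n , _)) _ = inj₁ n

    -- Translation between joins and linkings

    χ : Pred (V G) ℓ → Subset (V G)
    χ T x = ⌊ T x ⌋

    join⇒linking : ∀ {T} → Join G T → Linking AnyEdge (χ T)
    join⇒linking {T} J = record
      { Link = Link ; link-sym = link-sym ; irreflexive = irreflexive ; functional = functional
      ; link-T = link-T ; total = λ e → total (covers-once (sound e))
      ; walk = λ (i , o) → walk i o ; inside = λ _ _ → lift tt
      ; disjoint = λ (i , o) (j , o′) → disjoint i o j o′ }
      where
      open Join J

      Ends : Index → V G → V G → Set ℓ
      Ends i x y = (x ≡ source i × y ≡ target i) ⊎ (x ≡ target i × y ≡ source i)

      Link : V G → V G → Set ℓ
      Link x y = ∃ λ i → Ends i x y

      link-sym : ∀ {x y} → Link x y → Link y x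
      link-sym (i , inj₁ (p , q)) = i , inj₂ (q , p)
      link-sym (i , inj₂ (p , q)) = i , inj₁ (q , p)

      irreflexive : ∀ {x} → ¬ Link x x
      irreflexive (i , inj₁ (p , q)) = distinct-ends i (trans (sym p) q)
      irreflexive (i , inj₂ (p , q)) = distinct-ends i (trans (sym q) p)

      end∈T : ∀ {x} i → x ≡ source i ⊎ x ≡ target i → T x
      end∈T i (inj₁ refl) = source∈T i
      end∈T i (inj₂ refl) = target∈T i

      end : ∀ {i x y} → Ends i x y → x ≡ source i ⊎ x ≡ target i
      end (inj₁ (p , _)) = inj₁ p
      end (inj₂ (p , _)) = inj₂ p

      same-index : ∀ {i j x} → x ≡ source i ⊎ x ≡ target i → x ≡ source j ⊎ x ≡ target j → i ≡ j
      same-index {i} p q with _ , _ , unique ← covers-once (end∈T i p) = trans (sym (unique p)) (unique q)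

      functional : ∀ {x y z} → Link x y → Link x z → y ≡ z
      functional (i , o) (j , o′) with refl ← same-index (end o) (end o′) = go o o′
        where
        go : ∀ {x y z} → Ends i x y → Ends i x z → y ≡ z
        go (inj₁ (_ , refl)) (inj₁ (_ , refl)) = refl
        go (inj₂ (_ , refl)) (inj₂ (_ , refl)) = refl
        go (inj₁ (p , _))    (inj₂ (q , _))    = contradiction (trans (sym p) q) (distinct-ends i)
        go (inj₂ (p , _))    (inj₁ (q , _))    = contradiction (trans (sym q) p) (distinct-ends i)

      link-T : ∀ {x y} → Link x y → χ T x ≡ true
      link-T (i , o) = complete (end∈T i (end o))

      total : ∀ {x} → ∃! _≡_ (λ i → x ≡ source i ⊎ x ≡ target i) → ∃ λ y → Link x y
      total (i , inj₁ p , _) = target i , i , inj₁ (p , refl)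
      total (i , inj₂ p , _) = source i , i , inj₂ (p , refl)

      walk′ : ∀ {x y} i → Ends i x y → WalkIn (λ e → e ∈ˡ pathEdges (path i)) x y
      walk′ i (inj₁ (refl , refl)) = restrict (Path.walk (path i)) λ m → m
      walk′ i (inj₂ (refl , refl)) = sym-walk (restrict (Path.walk (path i)) λ m → m)

      walk : ∀ {x y} i → Ends i x y → Walk x y
      walk i o = forget (walk′ i o)

      disjoint : ∀ {x y x′ y′} i (o : Ends i x y) j (o′ : Ends j x′ y′) {e} →
                 e ∈ˡ edges (walk i o) → e ∈ˡ edges (walk j o′) → x ≡ x′ ⊎ y ≡ x′
      disjoint i o j o′ m m′ with decide (i ≡ j)
      ... | no i≢j   = ⊥-elim (edge-disjoint i≢j (forget-in (walk′ i o) m , forget-in (walk′ j o′) m′))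
      ... | yes refl = go o o′
        where
        go : ∀ {x y x′ y′} → Ends i x y → Ends i x′ y′ → x ≡ x′ ⊎ y ≡ x′
        go (inj₁ (refl , _)) (inj₁ (refl , _)) = inj₁ refl
        go (inj₂ (refl , _)) (inj₂ (refl , _)) = inj₁ refl
        go (inj₁ (_ , refl)) (inj₂ (refl , _)) = inj₂ refl
        go (inj₂ (_ , refl)) (inj₁ (refl , _)) = inj₂ refl

    choice : (S : Subset (V G)) → Dec (∃ λ x → S x ≡ true) → Maybe (V G)
    choice S (yes (x , _)) = just x
    choice S (no _)        = nothing

    linking⇒join : ∀ {T} → Linking AnyEdge (χ T) → Join G T
    linking⇒join {T} L = record
      { Index = Index ; source = proj₁ ; target = λ i → proj₁ (target i)
      ; path = λ i → proj₁ (path i)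
      ; edge-disjoint = λ {i} {j} i≢j (m , m′) → i≢j (clash i j
          (disjoint (proj₂ (target i)) (proj₂ (target j)) (proj₂ (path i) m) (proj₂ (path j) m′)))
      ; distinct-ends = λ i e → irreflexive (subst (Link (proj₁ i)) (sym e) (proj₂ (target i)))
      ; source∈T = λ i → sound (link-T (proj₂ (target i)))
      ; target∈T = λ i → sound (link-T (link-sym (proj₂ (target i))))
      ; covers-once = λ Tx → covers-once (total (complete Tx)) }
      where
      open Linking L

      pair : V G → Subset (V G)
      pair x y = ⌊ y ≡ x ⊎ Link x y ⌋

      pair-link : ∀ {x y} → Link x y → pair x ≡ pair y
      pair-link {x} {y} l = ⊆-antisym
        (λ z e → complete (go l (sound e))) (λ z e → complete (go (link-sym l) (sound e)))
        where
        go : ∀ {x y z} → Link x y → z ≡ x ⊎ Link x z → z ≡ y ⊎ Link y z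
        go l (inj₁ refl) = inj₂ (link-sym l)
        go l (inj₂ l′)   = inj₁ (functional l′ l)

      -- Linked vertices have equal `pair` sets by extensionality, so `em` returns the same witness
      -- for both: this selects one end of each pair consistently.
      leader : V G → Maybe (V G)
      leader x = choice (pair x) em

      leader-spec : ∀ x → ∃ λ y → leader x ≡ just y × (y ≡ x ⊎ Link x y)
      leader-spec x = go em
        where
        go : (d : Dec (∃ λ y → pair x y ≡ true)) → ∃ λ y → choice (pair x) d ≡ just y × (y ≡ x ⊎ Link x y)
        go (yes (y , e)) = y , refl , sound e
        go (no none)     = contradiction (x , complete (inj₁ refl)) none

      leader-link : ∀ {x y} → Link x y → leader x ≡ leader y
      leader-link l = cong (λ S → choice S em) (pair-link l)

      -- Of every linked pair, the vertex picked by the choice operator is the source.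
      Index : Set ℓ
      Index = Σ (V G) λ x → ⌊ T x × leader x ≡ just x ⌋ ≡ true

      index-≡ : {i j : Index} → proj₁ i ≡ proj₁ j → i ≡ j
      index-≡ {x , p} {_ , q} refl = cong (x ,_) (uip p q)

      target : (i : Index) → ∃ λ y → Link (proj₁ i) y
      target (x , p) = total (complete (proj₁ (sound {P = T x × leader x ≡ just x} p)))

      is-leader : (i : Index) → leader (proj₁ i) ≡ just (proj₁ i)
      is-leader (x , p) = proj₂ (sound {P = T x × leader x ≡ just x} p)

      path : (i : Index) → Σ (Path (proj₁ i) (proj₁ (target i))) λ p →
             ∀ {e} → e ∈ˡ pathEdges p → e ∈ˡ edges (walk (proj₂ (target i)))
      path i = simplify (restrict (walk (proj₂ (target i))) λ m → m)

      linked-leaders : ∀ i j → Link (proj₁ i) (proj₁ j) → i ≡ j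
      linked-leaders i j l = index-≡ (just-injective
        (trans (sym (is-leader i)) (trans (leader-link l) (is-leader j))))

      clash : ∀ i j → proj₁ i ≡ proj₁ j ⊎ proj₁ (target i) ≡ proj₁ j → i ≡ j
      clash i j (inj₁ e) = index-≡ e
      clash i j (inj₂ e) = linked-leaders i j (subst (Link (proj₁ i)) e (proj₂ (target i)))

      covers-once : ∀ {x} → (∃ λ y → Link x y) → ∃! _≡_ λ i → x ≡ proj₁ i ⊎ x ≡ proj₁ (target i)
      covers-once {x} (y , l) with leader-spec x
      ... | z , e , inj₁ refl = i , inj₁ refl , unique
        where
        i : Index
        i = x , complete (sound (link-T l) , e)
        unique : ∀ {j} → x ≡ proj₁ j ⊎ x ≡ proj₁ (target j) → i ≡ j
        unique (inj₁ p) = index-≡ p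
        unique {j} (inj₂ p) = sym (linked-leaders j i (subst (Link (proj₁ j)) (sym p) (proj₂ (target j))))
      ... | z , e , inj₂ l′ = i , inj₂ (functional (link-sym l′) (proj₂ (target i))) , unique
        where
        i : Index
        i = z , complete (sound (link-T (link-sym l′)) , trans (sym (leader-link l′)) e)
        unique : ∀ {j} → x ≡ proj₁ j ⊎ x ≡ proj₁ (target j) → i ≡ j
        unique {j} (inj₁ p) = linked-leaders i j (subst (Link z) p (link-sym l′))
        unique {j} (inj₂ p) =
          index-≡ (functional l′ (link-sym (subst (Link (proj₁ j)) (sym p) (proj₂ (target j)))))

    -- The three cases

    module Trichotomy (connected : Connected G) (T : Pred (V G) ℓ) where

      Joinable : Subset (V G) → Set (Level.suc ℓ)
      Joinable = Linking AnyEdge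

      route-between : ∀ u v → Walk u v
      route-between u v = Path.walk (proj₂ connected u v)

      joinable-⊕² : ∀ {S} u v → Joinable S → Joinable (S ⊕ u ⊕ v)
      joinable-⊕² u v = Exchange.exchange (route-between u v)

      joinable-or-⊕ : ∀ S v → Joinable S ⊎ Joinable (S ⊕ v)
      joinable-or-⊕ S v = Connected-part.linking-or-toggled AnyEdge v S
        λ {x} _ → restrict (route-between x v) λ _ → lift tt

      joinable-even : ∀ {S} xs → odd xs ≡ false → Joinable S → Joinable (S ⊕⋆ xs)
      joinable-even []           _ J = J
      joinable-even (x ∷ [])     () J
      joinable-even (x ∷ y ∷ xs) e J = joinable-⊕² y x (joinable-even xs (trans (sym (not-involutive _)) e) J)

      -- Adding `r` to the list makes it even, and this `r` cancels the one already toggled in the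
      -- hypothesis.
      joinable-odd : ∀ {S} r xs → odd xs ≡ true → Joinable (S ⊕ r) → Joinable (S ⊕⋆ xs)
      joinable-odd {S} r xs e J = subst Joinable
        (trans (cong (_⊕ r) (sym (⊕⋆-⊕ S xs r))) (⊕-cancel (S ⊕⋆ xs) r))
        (joinable-even (r ∷ xs) (cong not e) J)

      odd-spec : (xs : List (V G)) → (odd xs ≡ false × 2 ∣ length xs) ⊎ (odd xs ≡ true × 2 ∤ length xs)
      odd-spec []       = inj₁ (refl , 2 ∣0)
      odd-spec (_ ∷ []) = inj₂ (refl , λ { (divides zero ()) ; (divides (suc _) ()) })
      odd-spec (_ ∷ _ ∷ xs) with odd-spec xs
      ... | inj₁ (e , d) = inj₁ (trans (not-involutive _) e , ∣m∣n⇒∣m+n ∣-refl d)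
      ... | inj₂ (e , d) = inj₂ (trans (not-involutive _) e , λ d′ → d (∣m+n∣m⇒∣n d′ ∣-refl))

      -- A repeated entry would cancel itself; uniqueness rules this out.
      unique-toggles : ∀ (xs : List (V G)) → Unique xs → ∀ x → x ∈ˡ xs → (∅ ⊕⋆ xs) x ≡ true
      unique-toggles (y ∷ xs) (y∉ ∷ u) x = go (decide (x ≡ y))
        where
        ∉-toggles : (∅ ⊕⋆ xs) y ≡ false
        ∉-toggles with (∅ ⊕⋆ xs) y in e
        ... | false = refl
        ... | true  = contradiction (∈-toggles xs e) (All¬⇒¬Any y∉)

        go : Dec (x ≡ y) → x ∈ˡ y ∷ xs → (∅ ⊕⋆ (y ∷ xs)) x ≡ true
        go (yes refl) _         = trans (⊕-same (∅ ⊕⋆ xs) x) (cong not ∉-toggles)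
        go (no x≢y) (here e)    = contradiction e x≢y
        go (no x≢y) (there m)   = trans (⊕-other (∅ ⊕⋆ xs) x≢y) (unique-toggles xs u x m)

      ⊕⋆-pointwise : ∀ (S : Subset (V G)) xs x → (S ⊕⋆ xs) x ≡ S x xor (∅ ⊕⋆ xs) x
      ⊕⋆-pointwise S []       x = sym (xor-identityʳ _)
      ⊕⋆-pointwise S (y ∷ xs) x = trans (cong (_xor ⌊ x ≡ y ⌋) (⊕⋆-pointwise S xs x)) (xor-assoc (S x) _ _)

      χ-△ : ∀ {T′ : Pred (V G) ℓ} {xs} → Unique xs → (∀ x → x ∈ (T′ △ T) ⇔ x ∈ˡ xs) → χ T′ ≡ χ T ⊕⋆ xs
      χ-△ {T′} {xs} u △⇔ = ext λ x → trans
        (go (decide (T x)) (decide (T′ x)) (∅-spec x))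
        (sym (⊕⋆-pointwise (χ T) xs x))
        where
        ∅-spec : ∀ x → ((∅ ⊕⋆ xs) x ≡ true × (T′ △ T) x) ⊎ ((∅ ⊕⋆ xs) x ≡ false × ¬ (T′ △ T) x)
        ∅-spec x with (∅ ⊕⋆ xs) x in e
        ... | true  = inj₁ (refl , Equivalence.from (△⇔ x) (∈-toggles xs e))
        ... | false = inj₂ (refl , λ d → contradiction
          (trans (sym e) (unique-toggles xs u x (Equivalence.to (△⇔ x) d))) λ ())

        go : ∀ {x} → Dec (T x) → Dec (T′ x) → _ → χ T′ x ≡ χ T x xor (∅ ⊕⋆ xs) x
        go (yes t) (yes t′) (inj₁ (_ , inj₁ (_ , f))) = contradiction t′ f
        go (yes t) (yes t′) (inj₁ (_ , inj₂ (_ , f))) = contradiction t f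
        go (no f)  (no f′)  (inj₁ (_ , inj₁ (t , _))) = contradiction t f
        go (no f)  (no f′)  (inj₁ (_ , inj₂ (t , _))) = contradiction t f′
        go (yes t) (no f)   (inj₁ (e , _)) = trans (complete⁻ f) (sym (cong₂ _xor_ (complete t) e))
        go (no f)  (yes t)  (inj₁ (e , _)) = trans (complete t) (sym (cong₂ _xor_ (complete⁻ f) e))
        go (yes t) (yes t′) (inj₂ (e , _)) = trans (complete t′) (sym (cong₂ _xor_ (complete t) e))
        go (no f)  (no f′)  (inj₂ (e , _)) = trans (complete⁻ f′) (sym (cong₂ _xor_ (complete⁻ f) e))
        go (yes t) (no f)   (inj₂ (_ , d)) = contradiction (inj₁ (t , f)) d
        go (no f)  (yes t)  (inj₂ (_ , d)) = contradiction (inj₂ (t , f)) d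

      property-A : ∀ r → Joinable (χ T) → Joinable (χ T ⊕ r) → PropertyA G T
      property-A r J Jr T′ (_ , xs , u , _ , △⇔) = linking⇒join (subst Joinable (sym (χ-△ u △⇔)) go)
        where
        go : Joinable (χ T ⊕⋆ xs)
        go with odd-spec xs
        ... | inj₁ (e , _) = joinable-even xs e J
        ... | inj₂ (e , _) = joinable-odd r xs e Jr

      -- In the odd case, toggling `xs` once more and then `r`, an even number of toggles, would
      -- turn a linking for `T′` into one for `χ T ⊕ r`.
      property-B : ∀ r → Joinable (χ T) → ¬ Joinable (χ T ⊕ r) → PropertyB G T
      property-B r J ¬Jr T′ _ (xs , u , refl , △⇔) with odd-spec xs | χ-△ u △⇔
      ... | inj₁ (e , even) | χ≡ =
        (λ _ → linking⇒join (subst Joinable (sym χ≡) (joinable-even xs e J))) , λ odd → contradiction even odd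
      ... | inj₂ (e , odd) | χ≡ = (λ even → contradiction even odd) , λ _ J′ → ¬Jr
        (subst Joinable (cong (_⊕ r) (⊕⋆-cancel (χ T) xs))
          (joinable-even (r ∷ xs) (cong not e) (subst Joinable χ≡ (join⇒linking J′))))

      property-C : ∀ r → ¬ Joinable (χ T) → Joinable (χ T ⊕ r) → PropertyC G T
      property-C r ¬J Jr T′ _ (xs , u , refl , △⇔) with odd-spec xs | χ-△ u △⇔
      ... | inj₁ (e , even) | χ≡ = (λ odd → contradiction even odd) , λ _ J′ → ¬J
        (subst Joinable (⊕⋆-cancel (χ T) xs)
          (joinable-even xs e (subst Joinable χ≡ (join⇒linking J′))))
      ... | inj₂ (e , odd) | χ≡ =
        (λ _ → linking⇒join (subst Joinable (sym χ≡) (joinable-odd r xs e Jr))) ,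
        λ even → contradiction even odd

      toggled : V G → Pred (V G) ℓ
      toggled r x = Lift ℓ ((χ T ⊕ r) x ≡ true)

      χ-toggled : ∀ r → χ (toggled r) ≡ χ T ⊕ r
      χ-toggled r = ⊆-antisym (λ x e → lower (sound {P = toggled r x} e)) (λ x e → complete (lift e))

      size-zero : HasSize (T △ T) 0
      size-zero = [] , [] , refl , λ x →
        mk⇔ (λ { (inj₁ (t , f)) → contradiction t f ; (inj₂ (t , f)) → contradiction t f }) λ ()

      size-one : ∀ r → HasSize (toggled r △ T) 1
      size-one r = r ∷ [] , [] ∷ [] , refl , λ x →
        mk⇔ (to x (decide (x ≡ r))) λ { (here refl) → of (decide (T r)) }
        where
        to : ∀ x → Dec (x ≡ r) → x ∈ (toggled r △ T) → x ∈ˡ r ∷ []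
        to x (yes e)  _                   = here e
        to x (no x≢r) (inj₁ (t , f))      = contradiction (lift (trans (⊕-other (χ T) x≢r) (complete t))) f
        to x (no x≢r) (inj₂ (lift e , f)) = contradiction (sound (trans (sym (⊕-other (χ T) x≢r)) e)) f

        of : Dec (T r) → r ∈ (toggled r △ T)
        of (yes t) = inj₁ (t , λ { (lift e) → contradiction
          (trans (sym (cong not (complete t))) (trans (sym (⊕-same (χ T) r)) e)) λ () })
        of (no f)  = inj₂ (lift (trans (⊕-same (χ T) r) (cong not (complete⁻ f))) , f)

      2∤1 : 2 ∤ 1
      2∤1 (divides zero ())
      2∤1 (divides (suc _) ())

      linked-toggled : ∀ r → Join G (toggled r) → Joinable (χ T ⊕ r)
      linked-toggled r J = subst Joinable (χ-toggled r) (join⇒linking J)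

      joined-toggled : ∀ r → Joinable (χ T ⊕ r) → Join G (toggled r)
      joined-toggled r J = linking⇒join (subst Joinable (sym (χ-toggled r)) J)

      -- Two test sets tell the properties apart: `T` itself, at distance 0, and `T` with one vertex
      -- toggled, at distance 1. At least one of them is joinable by `joinable-or-⊕`.
      exactly-one : ExactlyOne (PropertyA G T) (PropertyB G T) (PropertyC G T)
      exactly-one with decide (Joinable (χ T)) | decide (Joinable (χ T ⊕ proj₁ connected))
      ... | yes J | yes Jr = inj₁ (property-A r J Jr ,
              (λ B → proj₂ (B _ 1 (size-one r)) 2∤1 (joined-toggled r Jr)) ,
              (λ C → proj₂ (C _ 0 size-zero) (2 ∣0) (linking⇒join J)))
        where r = proj₁ connected
      ... | yes J | no ¬Jr = inj₂ (inj₁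
              ( (λ A → ¬Jr (linked-toggled r (A _ (1 , size-one r)))) , property-B r J ¬Jr
              , λ C → proj₂ (C _ 0 size-zero) (2 ∣0) (linking⇒join J)))
        where r = proj₁ connected
      ... | no ¬J | yes Jr = inj₂ (inj₂
              ( (λ A → ¬J (join⇒linking (A _ (0 , size-zero))))
              , (λ B → ¬J (join⇒linking (proj₁ (B _ 0 size-zero) (2 ∣0))))
              , property-C r ¬J Jr))
        where r = proj₁ connected
      ... | no ¬J | no ¬Jr with joinable-or-⊕ (χ T) (proj₁ connected)
      ...   | inj₁ J  = contradiction J ¬J
      ...   | inj₂ Jr = contradiction Jr ¬Jr

  -- A pair for each property

  module Examples (ℓ : Level) where

    point : Graph ℓ
    point = record { V = Lift ℓ ⊤ ; E = Lift ℓ ⊥ ; end₁ = λ () ; end₂ = λ () ; loopless = λ () }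

    point-connected : Connected point
    point-connected = lift tt , λ _ _ → record { walk = Graph.nil ; simple = [] ∷ [] }

    module Point = Linked point

    point-empty : ∀ {S} → S (lift tt) ≡ false → Walks.Linking point Point.AnyEdge S
    point-empty ∉S = record
      { Link = λ _ _ → Lift ℓ ⊥ ; link-sym = λ () ; irreflexive = λ () ; functional = λ ()
      ; link-T = λ () ; total = λ ∈S → contradiction (trans (sym ∉S) ∈S) λ ()
      ; walk = λ () ; inside = λ () ; disjoint = λ () }

    point-full : ∀ {S} → S (lift tt) ≡ true → ¬ Walks.Linking point Point.AnyEdge S
    point-full ∈S L = Walks.Linking.irreflexive L (proj₂ (Walks.Linking.total L ∈S))

    -- On a single vertex only the empty set has a join, so the empty set gives B and the full set
    -- gives C.
    example-B : SomePairSatisfies ℓ PropertyB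
    example-B = point , point-connected , T , Point.Trichotomy.property-B point-connected T (lift tt)
      (point-empty {Point.χ T} (complete⁻ lower))
      (point-full (trans (⊕-same (Point.χ T) _) (cong not (complete⁻ lower))))
      where
      T : Pred (Lift ℓ ⊤) ℓ
      T _ = Lift ℓ ⊥

    example-C : SomePairSatisfies ℓ PropertyC
    example-C = point , point-connected , T , Point.Trichotomy.property-C point-connected T (lift tt)
      (point-full {Point.χ T} (complete (lift tt)))
      (point-empty (trans (⊕-same (Point.χ T) _) (cong not (complete (lift tt)))))
      where
      T : Pred (Lift ℓ ⊤) ℓ
      T _ = Lift ℓ ⊤

    ℕ↑ : Set ℓ
    ℕ↑ = Lift ℓ ℕ

    -- Edges are ordered pairs, so any two vertices are joined by two parallel edges and each
    -- ordered link has an edge of its own.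
    complete-graph : Graph ℓ
    complete-graph = record
      { V = ℕ↑ ; E = ∃ λ ((x , y) : ℕ↑ × ℕ↑) → x ≢ y
      ; end₁ = λ e → proj₁ (proj₁ e) ; end₂ = λ e → proj₂ (proj₁ e) ; loopless = proj₂ }

    open Graph complete-graph using (Path)
    open Walks complete-graph using (Linking)
    open Linked complete-graph using (AnyEdge; χ; module Trichotomy)

    complete-connected : Connected complete-graph
    complete-connected = lift 0 , λ x y → path (decide (x ≡ y))
      where
      path : ∀ {x y} → Dec (x ≡ y) → Path x y
      path (yes refl) = record { walk = Graph.nil ; simple = [] ∷ [] }
      path (no x≢y)   = record
        { walk   = Graph.cons (_ , x≢y) (inj₁ (refl , refl)) Graph.nil
        ; simple = (x≢y ∷ []) ∷ [] ∷ [] }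

    perfect⇒linking : ∀ {S μ} → Perfect (λ x → S x ≡ true) μ → Linking AnyEdge S
    perfect⇒linking {S} {μ} perfect = record
      { Link = Link
      ; link-sym = λ { (Sx , refl) → let Sμx , e , _ = perfect Sx in Sμx , e }
      ; irreflexive = λ (Sx , e) → proj₂ (proj₂ (perfect Sx)) e
      ; functional = λ (_ , e) (_ , e′) → trans (sym e) e′
      ; link-T = proj₁ ; total = λ Sx → _ , Sx , refl
      ; walk = λ l → Graph.cons (_ , link-≢ l) (inj₁ (refl , refl)) Graph.nil
      ; inside = λ _ _ → lift tt
      ; disjoint = λ { l l′ (here refl) (here e) → inj₁ (cong (λ f → proj₁ (proj₁ f)) e) } }
      where
      Link : ℕ↑ → ℕ↑ → Set ℓ
      Link x y = S x ≡ true × μ x ≡ y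

      link-≢ : ∀ {x y} → Link x y → x ≢ y
      link-≢ (Sx , refl) e = proj₂ (proj₂ (perfect Sx)) (sym e)

    flip : ℕ → ℕ
    flip 0             = 1
    flip 1             = 0
    flip (suc (suc n)) = suc (suc (flip n))

    flip-involutive : ∀ n → flip (flip n) ≡ n
    flip-involutive 0             = refl
    flip-involutive 1             = refl
    flip-involutive (suc (suc n)) = cong (λ k → suc (suc k)) (flip-involutive n)

    flip-≢ : ∀ n → flip n ≢ n
    flip-≢ 0 ()
    flip-≢ 1 ()
    flip-≢ (suc (suc n)) e = flip-≢ n (suc-injective (suc-injective e))

    -- Parity forces `T` to be infinite here. All of the naturals are paired as 2k with 2k+1, and
    -- the positive ones, left after toggling 0, as 2k+1 with 2k+2.
    example-A : SomePairSatisfies ℓ PropertyA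
    example-A = complete-graph , complete-connected , T ,
      Trichotomy.property-A complete-connected T (lift 0)
        (perfect⇒linking {μ = λ (lift n) → lift (flip n)} λ {(lift n)} _ →
          complete (lift tt) , cong lift (flip-involutive n) , λ e → flip-≢ n (cong lower e))
        (perfect⇒linking {μ = μ} (λ {(lift n)} → positive n))
      where
      T : Pred ℕ↑ ℓ
      T _ = Lift ℓ ⊤

      μ : ℕ↑ → ℕ↑
      μ (lift zero)    = lift zero
      μ (lift (suc n)) = lift (suc (flip n))

      positive : ∀ n → (χ T ⊕ lift 0) (lift n) ≡ true →
        (χ T ⊕ lift 0) (μ (lift n)) ≡ true × μ (μ (lift n)) ≡ lift n × μ (lift n) ≢ lift n
      positive zero    e = contradiction
        (trans (sym e) (trans (⊕-same (χ T) (lift 0)) (cong not (complete (lift tt))))) λ ()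
      positive (suc n) _ = trans (⊕-other (χ T) λ ()) (complete (lift tt)) ,
        cong (λ k → lift (suc k)) (flip-involutive n) , λ e → flip-≢ n (suc-injective (cong lower e))

theorem3 : (∀ {a} → ExcludedMiddle a) →
    (∀ {a b} → Extensionality a b) →
    ∀ ℓ →
    (∀ (G : Graph ℓ) → Connected G → (T : Pred (V G) ℓ) →
    ExactlyOne (PropertyA G T) (PropertyB G T) (PropertyC G T))
    × SomePairSatisfies ℓ PropertyA
    × SomePairSatisfies ℓ PropertyB
    × SomePairSatisfies ℓ PropertyC
theorem3 em ext ℓ =
  (λ G connected T → Linked.Trichotomy.exactly-one G connected T) , example-A , example-B , example-C
  where
  open Classical em ext
  open Examples ℓ
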